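{- For every integer $k\geq 2$, there exists an infinite family of $2k$-ordered simple graphs each of which has minimum degree $2k-1$ and maximum degree $2k+2$.
   Context: All graphs are finite and simple. A simple graph $G$ is $r$-ordered if, for every sequence $v_1, \ldots, v_r$ of $r$ distinct vertices of $G$, there exists a cycle in $G$ containing $v_1, \ldots, v_r$ in this (cyclic) order. -}

module Defs where

open import Data.Nat using (ℕ; zero; suc; _≤_; _<_; _∸_; _*_)
open import Data.Fin using (Fin) renaming (_<_ to _<ᶠ_)
import Data.Fin as F
open import Data.Bool using (Bool; true; false; if_then_else_)
open import Data.List using (List; map; allFin)
open import Data.Nat.ListAction using (sum)
open import Data.Product using (Σ; ∃; _×_; _,_)
open import Relation.Binary.PropositionalEquality using (_≡_)
open import Function.Definitions using (Injective)

record SimpleGraph (n : ℕ) : Set where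
  field
    adj    : Fin n → Fin n → Bool
    sym    : ∀ i j → adj i j ≡ adj j i
    irrefl : ∀ i → adj i i ≡ false
open SimpleGraph public

Adj : ∀ {n} → SimpleGraph n → Fin n → Fin n → Set
Adj G i j = adj G i j ≡ true

degree : ∀ {n} → SimpleGraph n → Fin n → ℕ
degree {n} G i = sum (map (λ j → if adj G i j then 1 else 0) (allFin n))

HasMinDegree : ∀ {n} → SimpleGraph n → ℕ → Set
HasMinDegree {n} G d = (∀ i → d ≤ degree G i) × (∃ λ i → degree G i ≡ d)

HasMaxDegree : ∀ {n} → SimpleGraph n → ℕ → Set
HasMaxDegree {n} G d = (∀ i → degree G i ≤ d) × (∃ λ i → degree G i ≡ d)

record Cycle {n : ℕ} (G : SimpleGraph n) : Set where
  field
    m         : ℕ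
    long      : 2 ≤ m
    vertex    : Fin (suc m) → Fin n
    distinct  : Injective _≡_ _≡_ vertex
    step      : ∀ (i : Fin m) → Adj G (vertex (F.inject₁ i)) (vertex (F.suc i))
    close     : Adj G (vertex (F.fromℕ m)) (vertex F.zero)
open Cycle public

-- The cycle C contains v₁,…,v_r in this cyclic order: there are positions
-- p₁ < … < p_r along some traversal of C with C(pᵢ) = vᵢ.  (Every rotation
-- and reversal of a cycle is again a Cycle, so this is the cyclic order.)
ContainsInOrder : ∀ {n r} {G : SimpleGraph n} → Cycle G → (Fin r → Fin n) → Set
ContainsInOrder {r = r} C v =
  Σ (Fin r → Fin (suc (m C))) λ p →
    (∀ i → vertex C (p i) ≡ v i) × (∀ i j → i <ᶠ j → p i <ᶠ p j)

Ordered : ℕ → ∀ {n} → SimpleGraph n → Set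
Ordered r {n} G =
  (v : Fin r → Fin n) → Injective _≡_ _≡_ v → Σ (Cycle G) λ C → ContainsInOrder C v

{-# OPTIONS --safe #-}
module Submission where

-- Let d = 2k.  The vertices are the pairs (X , i) with X ∈ (ℤ/m)^d and i < d:
-- the d vertices over X form a clique, and (X , i) is joined to (X ± eᵢ , i), so
-- that lines in different directions are vertex-disjoint.  All degrees are d + 1.
-- An extra vertex, the hub, is joined to d − 1 vertices in cliques over constant
-- points; it has degree d − 1, and its neighbours have degree d + 2.
--
-- Every terminal leaves its clique twice along its own line.  A direction of a
-- line is unusable only if a nearby clique on that line contains another terminal;
-- counting shows that the clique then has an unaffected vertex to leave through
-- instead.  Each of these disjoint arms is followed to a coordinate value f used
-- nowhere else.  Two arms, ending at P and P′, are joined by changing one coordinate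
-- to another unused value z, all the others to those of P′, and that one last.  The
-- vertices passed on the way have an unused value in a coordinate other than their
-- own direction, so different links are disjoint.
--
-- If the hub is a terminal, it can be entered and left through two of its
-- neighbours, which are treated as extra terminals.  A clique is close to at most
-- one of the two, so the count above still works.

open import Defs hiding (sym; irrefl; m; long; distinct; step; close)
open import Data.Nat using (ℕ; zero; suc; _≤_; _<_; _+_; _*_; _∸_; _^_; z≤n; s≤s; s≤s⁻¹; NonZero)
open import Data.Nat.Properties
open import Data.Nat.DivMod using (_%_; _mod_; %-distribˡ-+; m%n%n≡m%n; m<n⇒m%n≡m; [m+n]%n≡m%n; m%n<n)
open import Data.Nat.ListAction using (sum)
open import Data.Fin using (Fin; zero; suc; toℕ; fromℕ; inject₁; punchIn)
import Data.Fin as F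
import Data.Fin.Properties as F
open import Data.Fin.Relation.Unary.Top using (view; ‵fromℕ; ‵inject₁; view-fromℕ; view-inject₁)
open import Data.Bool using (Bool; true; false; if_then_else_)
import Data.Bool as Bool
open import Data.List using (List; []; _∷_; _++_; map; length; lookup; tabulate; allFin; concat; filter; cartesianProduct; initLast; _∷ʳ′_)
open import Data.List.Properties using (length-++; length-++-comm; length-map; length-tabulate; ++-identityʳ; map-tabulate; tabulate-lookup; tabulate-cong)
open import Data.List.Membership.Propositional using (_∈_; _∉_)
open import Data.List.Membership.Propositional.Properties
import Data.List.Membership.DecPropositional as DecMembership
open import Data.List.Relation.Unary.Any using (here; there; index)
open import Data.List.Relation.Unary.Any.Properties using (lookup-index)
open import Data.List.Relation.Unary.All as All using (All; []; _∷_)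
import Data.List.Relation.Unary.All.Properties as All
open import Data.List.Relation.Unary.AllPairs using ([]; _∷_)
import Data.List.Relation.Unary.AllPairs.Properties as AllPairs
open import Data.List.Relation.Unary.Unique.Propositional using (Unique)
import Data.List.Relation.Unary.Unique.Propositional.Properties as Unique
open import Data.List.Relation.Binary.Disjoint.Propositional using (Disjoint)
open import Data.List.Relation.Binary.Sublist.Propositional as Sub using ([]; _∷_; _∷ʳ_) renaming (_⊆_ to _⊑_)
import Data.List.Relation.Binary.Sublist.Propositional.Properties as Sub
import Data.List.Relation.Binary.Permutation.Setoid.Properties as Permutation
open import Data.Maybe using (Maybe; just; nothing)
import Data.Maybe.Properties as Maybe
open import Data.Vec using (Vec; []; _∷_; _[_]≔_; replicate) renaming (lookup to infixl 9 _!_)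
import Data.Vec.Properties as Vec
open import Data.Product using (Σ; ∃; _×_; _,_; proj₁; proj₂)
import Data.Product.Properties as Product
open import Data.Sum using (_⊎_; inj₁; inj₂)
open import Data.Empty using (⊥; ⊥-elim)
open import Function using (_∘_; id; _↔_; mk↔ₛ′; Inverse)
open import Function.Definitions using (Injective)
open import Relation.Nullary using (¬_; Dec; yes; no; ⌊_⌋; ¬?; contradiction; _×-dec_; _⊎-dec_)
open import Relation.Unary using (Decidable)
open import Relation.Binary.Definitions using (DecidableEquality; Symmetric)
open import Relation.Binary.PropositionalEquality hiding (J)
open import Relation.Binary.Construct.Closure.ReflexiveTransitive as Star using (Star; ε; _◅_; _◅◅_; reverse)

-- Pigeonhole and greedy choice

module _ {A : Set} where

  lookup-injective : {xs : List A} → Unique xs → Injective _≡_ _≡_ (lookup xs)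
  lookup-injective {_ ∷ _} _ {zero} {zero} _ = refl
  lookup-injective {_ ∷ xs} (x≢ ∷ _) {zero} {suc j} eq = ⊥-elim (All.lookup x≢ (∈-lookup {xs = xs} j) eq)
  lookup-injective {_ ∷ xs} (x≢ ∷ _) {suc i} {zero} eq = ⊥-elim (All.lookup x≢ (∈-lookup {xs = xs} i) (sym eq))
  lookup-injective {_ ∷ _} (_ ∷ u) {suc i} {suc j} eq = cong suc (lookup-injective u eq)

  index-injective : {x y : A} {xs : List A} (p : x ∈ xs) (q : y ∈ xs) → index p ≡ index q → x ≡ y
  index-injective {xs = xs} p q eq =
    trans (lookup-index p) (trans (cong (lookup xs) eq) (sym (lookup-index q)))

  injective-∈⇒≤ : ∀ {n} {f : Fin n → A} {ys} → Injective _≡_ _≡_ f → (∀ i → f i ∈ ys) → n ≤ length ys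
  injective-∈⇒≤ f-inj f∈ = F.injective⇒≤ λ {i} {j} eq → f-inj (index-injective (f∈ i) (f∈ j) eq)

  unique-⊆⇒length-≤ : {xs ys : List A} → Unique xs → (∀ {x} → x ∈ xs → x ∈ ys) → length xs ≤ length ys
  unique-⊆⇒length-≤ {xs} u xs⊆ys = injective-∈⇒≤ (lookup-injective u) (λ i → xs⊆ys (∈-lookup {xs = xs} i))

module _ {A : Set} (_≟_ : DecidableEquality A) where

  open DecMembership _≟_ using (_∈?_)

  avoid : ∀ {t} {f : Fin t → A} → Injective _≡_ _≡_ f → (bad : List A) → length bad < t →
          ∃ λ i → f i ∉ bad
  avoid {f = f} f-inj bad short with F.any? (λ i → ¬? (f i ∈? bad))
  ... | yes found = found
  ... | no none   = contradiction (injective-∈⇒≤ f-inj all-bad) (<⇒≱ short)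
    where
    all-bad : ∀ i → f i ∈ bad
    all-bad i with f i ∈? bad
    ... | yes p = p
    ... | no ¬p = ⊥-elim (none (i , ¬p))

  -- Greedy choice: at each pick the barred values are `bad` and fewer than `r` earlier picks, hence
  -- fewer than `t` in all.
  avoid-distinctly : ∀ {r t} {f : Fin r → Fin t → A} → (∀ a → Injective _≡_ _≡_ (f a)) →
    (bad : List A) → length bad + r ≤ t →
    Σ (Fin r → Fin t) λ c → (∀ a → f a (c a) ∉ bad) × Injective _≡_ _≡_ (λ a → f a (c a))
  avoid-distinctly {zero} _ _ _ = (λ ()) , (λ ()) , λ { {()} }
  avoid-distinctly {suc r} {t} {f} f-inj bad enough
    with i , i∉ ← avoid (f-inj zero) bad (≤-trans (m≤m+n _ r) (subst (_≤ t) (+-suc _ r) enough))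
    with c , c∉ , c-inj ← avoid-distinctly {r} (f-inj ∘ suc) (f zero i ∷ bad)
                            (subst (_≤ t) (+-suc _ r) enough)
    = c⁺ , c⁺∉ , c⁺-inj
    where
    c⁺ : Fin (suc r) → Fin t
    c⁺ zero    = i
    c⁺ (suc a) = c a
    c⁺∉ : ∀ a → f a (c⁺ a) ∉ bad
    c⁺∉ zero    = i∉
    c⁺∉ (suc a) = c∉ a ∘ there
    c⁺-inj : Injective _≡_ _≡_ (λ a → f a (c⁺ a))
    c⁺-inj {zero}  {zero}  _  = refl
    c⁺-inj {zero}  {suc b} eq = ⊥-elim (c∉ b (here (sym eq)))
    c⁺-inj {suc a} {zero}  eq = ⊥-elim (c∉ a (here eq))
    c⁺-inj {suc a} {suc b} eq = cong suc (c-inj eq)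

-- Walks, paths and cycles as lists

module Walks {V : Set} (_≟_ : DecidableEquality V) (E : V → V → Set) where

  open DecMembership _≟_ using (_∈?_)

  -- The list holds only the interior of a walk, so that terminals and the paths between them can be
  -- concatenated without repeating an end.
  Chain : V → List V → V → Set
  Chain x []       y = E x y
  Chain x (z ∷ zs) y = E x z × Chain z zs y

  chain-++ : ∀ {x z y} xs {ys} → Chain x xs z → Chain z ys y → Chain x (xs ++ z ∷ ys) y
  chain-++ []       e       c = e , c
  chain-++ (_ ∷ xs) (e , b) c = e , chain-++ xs b c

  chain-split : ∀ {x z y} xs {ys} → Chain x (xs ++ z ∷ ys) y → Chain x xs z × Chain z ys y
  chain-split []       (e , c) = e , c
  chain-split (_ ∷ xs) (e , c) with b , c′ ← chain-split xs c = (e , b) , c′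

  Closed : List V → Set
  Closed []       = ⊥
  Closed (x ∷ xs) = Chain x xs x

  closed-rotate : ∀ xs ys → Closed (xs ++ ys) → Closed (ys ++ xs)
  closed-rotate []       ys       c = subst Closed (sym (++-identityʳ ys)) c
  closed-rotate (x ∷ xs) []       c = subst (λ l → Chain x l x) (++-identityʳ xs) c
  closed-rotate (x ∷ xs) (y ∷ ys) c with a , b ← chain-split xs c = chain-++ ys b a

  Within : (V → Set) → V → V → Set
  Within W x y = E x y × W x × W y

  within-sym : ∀ {W} → Symmetric E → Symmetric (Within W)
  within-sym E-sym (e , p , q) = E-sym e , q , p

  -- Connections are built as walks that may revisit vertices, since disjointness depends only on
  -- the region `W` they stay in. Cutting out loops leaves a path in the same region.
  loop-erase : ∀ {W : V → Set} {x a b y} → E x a → W a → Star (Within W) a b → E b y →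
          ∃ λ ps → Chain x ps y × All W ps × Unique ps
  loop-erase {a = a} x~a Wa ε b~y = a ∷ [] , (x~a , b~y) , Wa ∷ [] , [] ∷ []
  loop-erase {a = a} x~a Wa ((a~a′ , _ , Wa′) ◅ walk) b~y
    with ps , c , W-ps , u ← loop-erase a~a′ Wa′ walk b~y
    with a ∈? ps
  ... | no a∉ps = a ∷ ps , (x~a , c) , Wa ∷ W-ps , All.¬Any⇒All¬ ps a∉ps ∷ u
  -- `a` recurs further on, so the path may start at that occurrence.
  ... | yes a∈ps with pre , post , refl ← ∈-∃++ a∈ps =
    a ∷ post , (x~a , proj₂ (chain-split pre c)) , All.++⁻ʳ pre W-ps , unique-drop pre u
    where
    unique-drop : ∀ xs {ys : List V} → Unique (xs ++ ys) → Unique ys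
    unique-drop []       u       = u
    unique-drop (_ ∷ xs) (_ ∷ u) = unique-drop xs u

  blocks : ∀ {n} → (Fin n → V) → (Fin n → List V) → List V
  blocks u p = concat (tabulate λ i → u i ∷ p i)

  -- The end `y` of the last link is left open: it is the first terminal for a cycle inside the
  -- lattice and the hub for a cycle through the hub.
  chain-blocks : ∀ n (u : Fin (suc n) → V) (p : Fin (suc n) → List V) y →
    (∀ i → Chain (u (inject₁ i)) (p (inject₁ i)) (u (suc i))) →
    Chain (u (fromℕ n)) (p (fromℕ n)) y →
    Chain (u zero) (p zero ++ blocks (u ∘ suc) (p ∘ suc)) y
  chain-blocks zero    u p y _    last = subst (λ l → Chain (u zero) l y) (sym (++-identityʳ (p zero))) last
  chain-blocks (suc n) u p y link last =
    chain-++ (p zero) (link zero) (chain-blocks n (u ∘ suc) (p ∘ suc) y (link ∘ suc) last)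

  ⊑-blocks : ∀ {n} (u : Fin n → V) p → tabulate u ⊑ blocks u p
  ⊑-blocks {zero}  u p = []
  ⊑-blocks {suc n} u p = refl ∷ Sub.++⁺ˡ (p zero) (⊑-blocks (u ∘ suc) (p ∘ suc))

  unique-blocks : ∀ {n} {u : Fin n → V} {p} → Injective _≡_ _≡_ u → (∀ i → Unique (p i)) →
    (∀ i j → u i ∉ p j) → (∀ {i j} → i ≢ j → Disjoint (p i) (p j)) → Unique (blocks u p)
  unique-blocks {u = u} {p} u-inj p! u∉p p# =
    Unique.concat⁺ (All.tabulate⁺ λ i → All.¬Any⇒All¬ (p i) (u∉p i i) ∷ p! i) (AllPairs.tabulate⁺ separate)
    where
    separate : ∀ {i j} → i ≢ j → Disjoint (u i ∷ p i) (u j ∷ p j)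
    separate i≢j (here refl , here eq)  = i≢j (u-inj eq)
    separate i≢j (here refl , there q)  = u∉p _ _ q
    separate i≢j (there q , here refl)  = u∉p _ _ q
    separate i≢j (there q , there q′)   = p# i≢j (q , q′)

-- Sublists, cycles of a `SimpleGraph` and degrees

module _ {A : Set} where

  ⊑-++⁻ : ∀ (xs : List A) {ys zs} → xs ++ ys ⊑ zs →
          ∃ λ as → ∃ λ bs → zs ≡ as ++ bs × xs ⊑ as × ys ⊑ bs
  ⊑-++⁻ []       s = [] , _ , refl , [] , s
  ⊑-++⁻ (x ∷ xs) (y ∷ʳ s) with as , bs , refl , p , q ← ⊑-++⁻ (x ∷ xs) s = y ∷ as , bs , refl , y ∷ʳ p , q
  ⊑-++⁻ (x ∷ xs) (refl ∷ s) with as , bs , refl , p , q ← ⊑-++⁻ xs s = x ∷ as , bs , refl , refl ∷ p , q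

  -- An embedding of lists supplies the increasing positions that `ContainsInOrder` asks for.
  position : ∀ {n} (v : Fin n → A) {ys} → tabulate v ⊑ ys → Fin n → Fin (length ys)
  position {suc n} v (_ ∷ʳ s) i       = suc (position v s i)
  position {suc n} v (_ ∷ s)  zero    = zero
  position {suc n} v (_ ∷ s)  (suc i) = suc (position (v ∘ suc) s i)

  lookup-position : ∀ {n} (v : Fin n → A) {ys} (s : tabulate v ⊑ ys) i → lookup ys (position v s i) ≡ v i
  lookup-position {suc n} v (_ ∷ʳ s) i       = lookup-position v s i
  lookup-position {suc n} v (eq ∷ s) zero    = sym eq
  lookup-position {suc n} v (_ ∷ s)  (suc i) = lookup-position (v ∘ suc) s i

  position-mono : ∀ {n} (v : Fin n → A) {ys} (s : tabulate v ⊑ ys) i j → i F.< j → position v s i F.< position v s j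
  position-mono {suc n} v (_ ∷ʳ s) i       j       i<j       = s≤s (position-mono v s i j i<j)
  position-mono {suc n} v (_ ∷ s)  zero    (suc j) _         = s≤s z≤n
  position-mono {suc n} v (_ ∷ s)  (suc i) (suc j) (s≤s i<j) = s≤s (position-mono (v ∘ suc) s i j i<j)

module _ {n : ℕ} (G : SimpleGraph n) where

  open Walks (F._≟_ {n}) (Adj G)

  chain-step : ∀ x xs {y} → Chain x xs y → ∀ i → Adj G (lookup (x ∷ xs) (inject₁ i)) (lookup xs i)
  chain-step x (z ∷ zs) (e , _) zero    = e
  chain-step x (z ∷ zs) (_ , c) (suc i) = chain-step z zs c i

  chain-end : ∀ x xs {y} → Chain x xs y → Adj G (lookup (x ∷ xs) (fromℕ (length xs))) y
  chain-end x []       e       = e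
  chain-end x (z ∷ zs) (_ , c) = chain-end z zs c

  closed⇒cycle : ∀ {r} (v : Fin r → Fin n) → 3 ≤ r → ∀ c → Closed c → Unique c → tabulate v ⊑ c →
                 Σ (Cycle G) λ C → ContainsInOrder C v
  closed⇒cycle v 3≤r (x ∷ xs) c u s =
    record
      { m = length xs
      -- `m` is one less than the number of vertices, of which there are at least `r ≥ 3`.
      ; long = s≤s⁻¹ (≤-trans (subst (3 ≤_) (sym (length-tabulate v)) 3≤r) (Sub.length-mono-≤ s))
      ; vertex = lookup (x ∷ xs)
      ; distinct = lookup-injective u
      ; step = chain-step x xs c
      ; close = chain-end x xs c
      } , position v s , lookup-position v s , position-mono v s

  degree≡length : ∀ i → degree G i ≡ length (filter (λ j → adj G i j Bool.≟ true) (allFin n))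
  degree≡length i = count (allFin n)
    where
    count : ∀ js → sum (map (λ j → if adj G i j then 1 else 0) js) ≡ length (filter (λ j → adj G i j Bool.≟ true) js)
    count [] = refl
    count (j ∷ js) with adj G i j
    ... | true  = cong suc (count js)
    ... | false = count js

  degree-≥ : ∀ {i js} → Unique js → (∀ {j} → j ∈ js → Adj G i j) → length js ≤ degree G i
  degree-≥ {i} u ok = subst (_ ≤_) (sym (degree≡length i))
    (unique-⊆⇒length-≤ u λ j∈ → ∈-filter⁺ (λ j → adj G i j Bool.≟ true) (∈-allFin _) (ok j∈))

  degree-≤ : ∀ {i js} → (∀ {j} → Adj G i j → j ∈ js) → degree G i ≤ length js
  degree-≤ {i} ok = subst (_≤ _) (sym (degree≡length i))
    (unique-⊆⇒length-≤ (Unique.filter⁺ (λ j → adj G i j Bool.≟ true) (Unique.allFin⁺ n))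
      (λ j∈ → ok (proj₂ (∈-filter⁻ (λ j → adj G i j Bool.≟ true) {xs = allFin n} j∈))))

-- Addition on the cycle ℤ/m

module Cyclic (m : ℕ) .{{_ : NonZero m}} where

  infixl 6 _⊕_

  -- Shifts are natural numbers, so that they can be compared as lengths; a backward shift by `a` is
  -- a shift by `m ∸ a`.
  _⊕_ : Fin m → ℕ → Fin m
  c ⊕ a = (toℕ c + a) mod m

  toℕ-⊕ : ∀ c a → toℕ (c ⊕ a) ≡ (toℕ c + a) % m
  toℕ-⊕ c a = F.toℕ-fromℕ< (m%n<n (toℕ c + a) m)

  ⊕-assoc : ∀ c a b → c ⊕ a ⊕ b ≡ c ⊕ (a + b)
  ⊕-assoc c a b = F.toℕ-injective (begin
    toℕ (c ⊕ a ⊕ b)                    ≡⟨ toℕ-⊕ (c ⊕ a) b ⟩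
    (toℕ (c ⊕ a) + b) % m              ≡⟨ cong (λ x → (x + b) % m) (toℕ-⊕ c a) ⟩
    ((toℕ c + a) % m + b) % m          ≡⟨ %-distribˡ-+ ((toℕ c + a) % m) b m ⟩
    ((toℕ c + a) % m % m + b % m) % m  ≡⟨ cong (λ x → (x + b % m) % m) (m%n%n≡m%n (toℕ c + a) m) ⟩
    ((toℕ c + a) % m + b % m) % m      ≡⟨ %-distribˡ-+ (toℕ c + a) b m ⟨
    (toℕ c + a + b) % m                ≡⟨ cong (_% m) (+-assoc (toℕ c) a b) ⟩
    (toℕ c + (a + b)) % m              ≡⟨ toℕ-⊕ c (a + b) ⟨
    toℕ (c ⊕ (a + b))                  ∎)
    where open ≡-Reasoning

  ⊕-identity : ∀ c → c ⊕ 0 ≡ c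
  ⊕-identity c = F.toℕ-injective (trans (toℕ-⊕ c 0)
    (trans (cong (_% m) (+-identityʳ (toℕ c))) (m<n⇒m%n≡m (F.toℕ<n c))))

  ⊕-m : ∀ c → c ⊕ m ≡ c
  ⊕-m c = F.toℕ-injective (trans (toℕ-⊕ c m) (trans ([m+n]%n≡m%n (toℕ c) m) (m<n⇒m%n≡m (F.toℕ<n c))))

  ⊕-undo : ∀ c a → a ≤ m → c ⊕ (m ∸ a) ⊕ a ≡ c
  ⊕-undo c a a≤m = trans (⊕-assoc c (m ∸ a) a) (trans (cong (c ⊕_) (m∸n+n≡m a≤m)) (⊕-m c))

  ⊕-cancel : ∀ {c c′} a → a ≤ m → c ⊕ a ≡ c′ ⊕ a → c ≡ c′
  ⊕-cancel {c} {c′} a a≤m eq = begin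
    c                ≡⟨ round-trip c ⟨
    c ⊕ a ⊕ (m ∸ a)   ≡⟨ cong (_⊕ (m ∸ a)) eq ⟩
    c′ ⊕ a ⊕ (m ∸ a)  ≡⟨ round-trip c′ ⟩
    c′               ∎
    where
    open ≡-Reasoning
    round-trip : ∀ x → x ⊕ a ⊕ (m ∸ a) ≡ x
    round-trip x = trans (⊕-assoc x a (m ∸ a)) (trans (cong (x ⊕_) (m+[n∸m]≡n a≤m)) (⊕-m x))

  -- A shift below `m` either does not wrap around, and then it is 0, or wraps once, and then it
  -- would have to equal `m`.
  ⊕-moves : ∀ {c} a → a < m → c ⊕ a ≡ c → a ≡ 0
  ⊕-moves {c} a a<m eq with toℕ c + a <? m
  ... | yes small = +-cancelˡ-≡ (toℕ c) a 0 (begin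
    toℕ c + a        ≡⟨ m<n⇒m%n≡m small ⟨
    (toℕ c + a) % m  ≡⟨ toℕ-⊕ c a ⟨
    toℕ (c ⊕ a)      ≡⟨ cong toℕ eq ⟩
    toℕ c            ≡⟨ +-identityʳ (toℕ c) ⟨
    toℕ c + 0        ∎)
    where open ≡-Reasoning
  ... | no big = ⊥-elim (<⇒≢ a<m (+-cancelˡ-≡ (toℕ c) a m (begin
    toℕ c + a                  ≡⟨ m∸n+n≡m (≮⇒≥ big) ⟨
    (toℕ c + a ∸ m) + m        ≡⟨ cong (_+ m) reduced ⟩
    toℕ c + m                  ∎)))
    where
    open ≡-Reasoning
    below : toℕ c + a ∸ m < m
    below = m<n+o⇒m∸n<o (toℕ c + a) m (+-mono-< (F.toℕ<n c) a<m)
    reduced : toℕ c + a ∸ m ≡ toℕ c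
    reduced = begin
      toℕ c + a ∸ m              ≡⟨ m<n⇒m%n≡m below ⟨
      (toℕ c + a ∸ m) % m        ≡⟨ [m+n]%n≡m%n (toℕ c + a ∸ m) m ⟨
      (toℕ c + a ∸ m + m) % m    ≡⟨ cong (_% m) (m∸n+n≡m (≮⇒≥ big)) ⟩
      (toℕ c + a) % m            ≡⟨ toℕ-⊕ c a ⟨
      toℕ (c ⊕ a)                ≡⟨ cong toℕ eq ⟩
      toℕ c                      ∎

  ⊕-transitive : ∀ c c′ → ∃ λ a → c ⊕ a ≡ c′
  ⊕-transitive c c′ = m ∸ toℕ c + toℕ c′ , F.toℕ-injective (begin
    toℕ (c ⊕ (m ∸ toℕ c + toℕ c′))          ≡⟨ toℕ-⊕ c _ ⟩
    (toℕ c + (m ∸ toℕ c + toℕ c′)) % m      ≡⟨ cong (_% m) (+-assoc (toℕ c) _ _) ⟨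
    (toℕ c + (m ∸ toℕ c) + toℕ c′) % m      ≡⟨ cong (λ x → (x + toℕ c′) % m) (m+[n∸m]≡n (<⇒≤ (F.toℕ<n c))) ⟩
    (m + toℕ c′) % m                        ≡⟨ cong (_% m) (+-comm m (toℕ c′)) ⟩
    (toℕ c′ + m) % m                        ≡⟨ [m+n]%n≡m%n (toℕ c′) m ⟩
    toℕ c′ % m                              ≡⟨ m<n⇒m%n≡m (F.toℕ<n c′) ⟩
    toℕ c′                                  ∎)
    where open ≡-Reasoning

length-filter-split : ∀ {A : Set} {P : A → Set} (P? : Decidable P) xs →
  length (filter (¬? ∘ P?) xs) + length (filter P? xs) ≡ length xs
length-filter-split P? []       = refl
length-filter-split P? (x ∷ xs) with P? x
... | yes _ = trans (+-suc _ _) (cong suc (length-filter-split P? xs))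
... | no  _ = cong suc (length-filter-split P? xs)

lookup-ext : ∀ {A : Set} {n} {X Y : Vec A n} → (∀ i → X ! i ≡ Y ! i) → X ≡ Y
lookup-ext {X = []}    {[]}    _  = refl
lookup-ext {X = _ ∷ _} {_ ∷ _} eq = cong₂ _∷_ (eq zero) (lookup-ext (eq ∘ suc))


-- The lattice: cliques over points, and lines

module Lattice (d T m : ℕ) .{{_ : NonZero m}} (wide : T + T + (T + T) < m) where

  open Cyclic m public

  Point Vertex : Set
  Point  = Vec (Fin m) d
  Vertex = Point × Fin d

  _≟ᴾ_ : DecidableEquality Point
  _≟ᴾ_ = Vec.≡-dec F._≟_

  _≟ᵛ_ : DecidableEquality Vertex
  _≟ᵛ_ = Product.≡-dec _≟ᴾ_ F._≟_

  up : Point → Fin d → Point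
  up X i = X [ i ]≔ (X ! i ⊕ 1)

  E : Vertex → Vertex → Set
  E (X , i) (Y , j) = (X ≡ Y × i ≢ j) ⊎ (i ≡ j × (Y ≡ up X i ⊎ X ≡ up Y i))

  E-sym : Symmetric E
  E-sym (inj₁ (eq , i≢j))         = inj₁ (sym eq , i≢j ∘ sym)
  E-sym (inj₂ (refl , inj₁ eq))   = inj₂ (refl , inj₂ eq)
  E-sym (inj₂ (refl , inj₂ eq))   = inj₂ (refl , inj₁ eq)

  open Walks _≟ᵛ_ E public

  T≤m : T ≤ m
  T≤m = ≤-trans (m≤m+n T T) (≤-trans (m≤m+n (T + T) (T + T)) (<⇒≤ wide))

  2T<m : T + T < m
  2T<m = ≤-<-trans (m≤m+n (T + T) (T + T)) wide

  T<m : T < m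
  T<m = ≤-<-trans (m≤m+n T T) 2T<m

  ≔-same : ∀ (X : Point) i {c} → (X [ i ]≔ c) ! i ≡ c
  ≔-same X i {c} = Vec.lookup∘update i X c

  ≔-other : ∀ (X : Point) {i j} {c} → j ≢ i → (X [ i ]≔ c) ! j ≡ X ! j
  ≔-other X {c = c} j≢i = Vec.lookup∘update′ j≢i X c

  line-edge : ∀ (X : Point) i {c c′} → c′ ≡ c ⊕ 1 → E (X [ i ]≔ c , i) (X [ i ]≔ c′ , i)
  line-edge X i {c} refl = inj₂ (refl , inj₁ (sym (trans (Vec.[]≔-idempotent X i)
    (cong (λ z → X [ i ]≔ (z ⊕ 1)) (≔-same X i)))))

  -- The walk always runs forward, possibly the long way round; this is harmless because the whole
  -- line lies in `W`.
  line-walk : ∀ {W : Vertex → Set} X i → (∀ c → W (X [ i ]≔ c , i)) → ∀ c c′ →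
    Star (Within W) (X [ i ]≔ c , i) (X [ i ]≔ c′ , i)
  line-walk {W} X i inside c c′ with a , refl ← ⊕-transitive c c′ = go a
    where
    go : ∀ a → Star (Within W) (X [ i ]≔ c , i) (X [ i ]≔ (c ⊕ a) , i)
    go zero    = subst (λ z → Star (Within W) (X [ i ]≔ c , i) (X [ i ]≔ z , i)) (sym (⊕-identity c)) ε
    go (suc a) = go a ◅◅ (line-edge X i (trans (cong (c ⊕_) (+-comm 1 a)) (sym (⊕-assoc c a 1))) , inside _ , inside _) ◅ ε

  switch : ∀ {W : Vertex → Set} X i j → W (X , i) → W (X , j) → Star (Within W) (X , i) (X , j)
  switch X i j Wi Wj with i F.≟ j
  ... | yes refl = ε
  ... | no i≢j   = (inj₁ (refl , i≢j) , Wi , Wj) ◅ ε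

  -- Rays on a line and how they meet

  -- A direction true means forward.
  ray : Fin m → Bool → ℕ → Fin m
  ray c true  t = c ⊕ t
  ray c false t = c ⊕ (m ∸ t)

  -- The relational form of `y ≡ ray c s t`: it is purely additive and avoids the truncated
  -- subtraction in `ray`.
  On : Fin m → Bool → ℕ → Fin m → Set
  On c true  t y = y ≡ c ⊕ t
  On c false t y = c ≡ y ⊕ t

  on-ray : ∀ c s {t} → t ≤ m → On c s t (ray c s t)
  on-ray c true  _   = refl
  on-ray c false t≤m = sym (⊕-undo c _ t≤m)

  on-0 : ∀ c s {y} → On c s 0 y → y ≡ c
  on-0 c true  eq = trans eq (⊕-identity c)
  on-0 c false eq = trans (sym (⊕-identity _)) (sym eq)

  ray-0 : ∀ c s → ray c s 0 ≡ c
  ray-0 c s = on-0 c s (on-ray c s z≤n)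

  ⊕-injective-≤ : ∀ {c a b} → a ≤ b → b < m → c ⊕ b ≡ c ⊕ a → a ≡ b
  ⊕-injective-≤ {c} {a} {b} a≤b b<m eq = ≤-antisym a≤b (m∸n≡0⇒m≤n (⊕-moves (b ∸ a) (≤-<-trans (m∸n≤m b a) b<m)
    (⊕-cancel a (≤-trans a≤b (<⇒≤ b<m)) (trans (⊕-assoc c (b ∸ a) a) (trans (cong (c ⊕_) (m∸n+n≡m a≤b)) eq)))))

  ⊕-injectiveʳ : ∀ {c a b} → a < m → b < m → c ⊕ a ≡ c ⊕ b → a ≡ b
  ⊕-injectiveʳ {a = a} {b} a<m b<m eq with ≤-total a b
  ... | inj₁ a≤b = ⊕-injective-≤ a≤b b<m (sym eq)
  ... | inj₂ b≤a = sym (⊕-injective-≤ b≤a a<m eq)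

  on-injective : ∀ {c s t t′ y} → t < m → t′ < m → On c s t y → On c s t′ y → t ≡ t′
  on-injective {s = true}  t<m t′<m p q = ⊕-injectiveʳ t<m t′<m (trans (sym p) q)
  on-injective {s = false} t<m t′<m p q = ⊕-injectiveʳ t<m t′<m (trans (sym p) q)

  -- Opposite rays that meet close a loop of length `t + t′`, at most `2T < m`, so this length is 0.
  on-opposite : ∀ {c s t t′ y} → t ≤ T → t′ ≤ T → On c s t y → On c (Bool.not s) t′ y → t ≡ 0
  on-opposite {c} {true} {t} {t′} t≤ t′≤ refl q =
    m+n≡0⇒m≡0 t (⊕-moves (t + t′) (≤-<-trans (+-mono-≤ t≤ t′≤) 2T<m) (trans (sym (⊕-assoc c t t′)) (sym q)))
  on-opposite {c} {false} {t} {t′} t≤ t′≤ p refl =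
    m+n≡0⇒n≡0 t′ (⊕-moves (t′ + t) (≤-<-trans (+-mono-≤ t′≤ t≤) 2T<m) (trans (sym (⊕-assoc c t′ t)) (sym p)))

  -- The range is `2T` because rays of length at most `T` meet only if their origins are that close.
  Ahead : Fin m → Fin m → Set
  Ahead c c′ = ∃ λ (a : Fin (T + T)) → c′ ≡ c ⊕ suc (toℕ a)

  ahead : ∀ {c c′} a → c ≢ c′ → a ≤ T + T → c′ ≡ c ⊕ a → Ahead c c′
  ahead {c} zero    c≢c′ _    eq = ⊥-elim (c≢c′ (sym (trans eq (⊕-identity c))))
  ahead {c} (suc a) _    a<2T eq = F.fromℕ< a<2T , trans eq (cong (λ x → c ⊕ suc x) (sym (F.toℕ-fromℕ< a<2T)))

  Toward : Bool → Fin m → Fin m → Set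
  Toward true  c c′ = Ahead c c′
  Toward false c c′ = Ahead c′ c

  ⊕-compare : ∀ {c c′ a b} → c ≢ c′ → a ≤ T → b ≤ T → c ⊕ a ≡ c′ ⊕ b → Ahead c c′ ⊎ Ahead c′ c
  ⊕-compare {c} {c′} {a} {b} c≢c′ a≤ b≤ eq with ≤-total a b
  ... | inj₁ a≤b = inj₂ (ahead (b ∸ a) (c≢c′ ∘ sym) (≤-trans (m∸n≤m b a) (≤-trans b≤ (m≤m+n T T)))
        (⊕-cancel a (≤-trans a≤ T≤m) (trans eq (sym (trans (⊕-assoc c′ (b ∸ a) a) (cong (c′ ⊕_) (m∸n+n≡m a≤b)))))))
  ... | inj₂ b≤a = inj₁ (ahead (a ∸ b) c≢c′ (≤-trans (m∸n≤m a b) (≤-trans a≤ (m≤m+n T T)))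
        (⊕-cancel b (≤-trans b≤ T≤m) (trans (sym eq) (sym (trans (⊕-assoc c (a ∸ b) b) (cong (c ⊕_) (m∸n+n≡m b≤a)))))))

  -- With equal directions the rear ray points at the origin of the front one; with opposite
  -- directions the origins are `t + t′` apart and face each other.
  rays-meet : ∀ {c c′ t t′ y} s s′ → c ≢ c′ → t ≤ T → t′ ≤ T → On c s t y → On c′ s′ t′ y →
              Toward s c c′ ⊎ Toward s′ c′ c
  rays-meet true true c≢c′ t≤ t′≤ p q = ⊕-compare c≢c′ t≤ t′≤ (trans (sym p) q)
  rays-meet {c} {c′} {t} {t′} true false c≢c′ t≤ t′≤ refl q =
    inj₁ (ahead (t + t′) c≢c′ (+-mono-≤ t≤ t′≤) (trans q (⊕-assoc c t t′)))
  rays-meet {c} {c′} {t} {t′} false true c≢c′ t≤ t′≤ p refl =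
    inj₂ (ahead (t′ + t) (c≢c′ ∘ sym) (+-mono-≤ t′≤ t≤) (trans p (⊕-assoc c′ t′ t)))
  rays-meet {c} {c′} {t} {t′} {y} false false c≢c′ t≤ t′≤ p q
    = ⊕-compare (c≢c′ ∘ sym) t≤ t′≤ (trans (cong (_⊕ t) q) (trans (⊕-assoc y t′ t)
        (trans (cong (y ⊕_) (+-comm t′ t)) (trans (sym (⊕-assoc y t t′)) (cong (_⊕ t′) (sym p))))))

  on⇒toward : ∀ {c t y} s → c ≢ y → t ≤ T → On c s t y → Toward s c y
  on⇒toward true  c≢y t≤ p = ahead _ c≢y (≤-trans t≤ (m≤m+n T T)) p
  on⇒toward false c≢y t≤ p = ahead _ (c≢y ∘ sym) (≤-trans t≤ (m≤m+n T T)) p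

  ahead-≢ : ∀ {c c′} → Ahead c c′ → c′ ≢ c
  ahead-≢ (a , eq) c′≡c with () ← ⊕-moves (suc (toℕ a)) (≤-<-trans (F.toℕ<n a) 2T<m) (trans (sym eq) c′≡c)

  -- The two shifts together would return to the start after a positive length of at most `4T`,
  -- which `wide` keeps below `m`.
  ahead-asym : ∀ {c c′} → Ahead c c′ → ¬ Ahead c′ c
  ahead-asym {c} (a , refl) (b , eq)
    with () ← ⊕-moves (suc (toℕ a) + suc (toℕ b)) (≤-<-trans (+-mono-≤ (F.toℕ<n a) (F.toℕ<n b)) wide)
                (trans (sym (⊕-assoc c _ _)) (sym eq))

  -- Items of a clique and the vertices that hit them

  -- An item (l , κ) of a clique Q is its vertex (Q , l) (κ = nothing) or one of
  -- the two directions in which the line of (Q , l) leaves Q.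

  Item : Set
  Item = Fin d × Maybe Bool

  Shift : Point → Fin d → Point → Set
  Shift Q l Q′ = ∃ λ (a : Fin (T + T)) → Q′ ≡ Q [ l ]≔ (Q ! l ⊕ suc (toℕ a))

  -- A direction counts as hit by any terminal of a nearby clique on the line, because even one with
  -- another index may take this line as its substitute. The bounded offset in `Shift` keeps the
  -- relation decidable.
  Hits : Point → Item → Vertex → Set
  Hits Q (l , nothing)    v        = v ≡ (Q , l)
  Hits Q (l , just true)  (Q′ , _) = Shift Q l Q′
  Hits Q (l , just false) (Q′ , _) = Shift Q′ l Q

  Hits? : ∀ Q it v → Dec (Hits Q it v)
  Hits? Q (l , nothing)    v        = v ≟ᵛ (Q , l)
  Hits? Q (l , just true)  (Q′ , _) = F.any? λ _ → Q′ ≟ᴾ _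
  Hits? Q (l , just false) (Q′ , _) = F.any? λ _ → Q ≟ᴾ _

  shift⇒ahead : ∀ {Q l Q′} → Shift Q l Q′ → Ahead (Q ! l) (Q′ ! l)
  shift⇒ahead {Q} {l} (a , refl) = a , ≔-same Q l

  shift-agree : ∀ {Q l Q′ i} → Shift Q l Q′ → i ≢ l → Q′ ! i ≡ Q ! i
  shift-agree {Q} (a , refl) i≢l = ≔-other Q i≢l

  toward⇒hits : ∀ {Q l Q′ j} s → Q′ ≡ Q [ l ]≔ (Q′ ! l) → Toward s (Q ! l) (Q′ ! l) → Hits Q (l , just s) (Q′ , j)
  toward⇒hits {Q} {l} true  line (a , eq) = a , trans line (cong (Q [ l ]≔_) eq)
  toward⇒hits {Q} {l} {Q′} false line (a , eq) = a , trans back (cong (Q′ [ l ]≔_) eq)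
    where
    back : Q ≡ Q′ [ l ]≔ (Q ! l)
    back = sym (trans (cong (_[ l ]≔ (Q ! l)) line) (trans (Vec.[]≔-idempotent Q l) (Vec.[]≔-lookup Q l)))

  hits-agree : ∀ {Q v} it → Hits Q it v → ∀ i → i ≢ proj₁ it → proj₁ v ! i ≡ Q ! i
  hits-agree (l , nothing)    refl i i≢l = refl
  hits-agree (l , just true)  h    i i≢l = shift-agree h i≢l
  hits-agree (l , just false) h    i i≢l = sym (shift-agree h i≢l)

  hits-differ : ∀ {Q v} l s → Hits Q (l , just s) v → proj₁ v ! l ≢ Q ! l
  hits-differ l true  h eq = ahead-≢ (shift⇒ahead h) eq
  hits-differ l false h eq = ahead-≢ (shift⇒ahead h) (sym eq)

  hits-same-line : ∀ {Q v l l′} s s′ → Hits Q (l , just s) v → Hits Q (l′ , just s′) v → l ≡ l′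
  hits-same-line {l = l} {l′} s s′ h h′ with l F.≟ l′
  ... | yes eq = eq
  ... | no l≢l′ = ⊥-elim (hits-differ l s h (hits-agree (l′ , just s′) h′ l l≢l′))

  -- If `v` lies outside the clique `Q`, the one coordinate in which they differ fixes the line and
  -- `ahead-asym` fixes the direction. Hence the hit items of a clique never outnumber the terminals
  -- that hit them.
  hits-unique : ∀ {Q v} it it′ → Hits Q it v → Hits Q it′ v → it ≡ it′
  hits-unique (l , nothing) (l′ , nothing) refl refl = refl
  hits-unique (l , nothing) (l′ , just s′) refl h′ = ⊥-elim (hits-differ l′ s′ h′ refl)
  hits-unique (l , just s)  (l′ , nothing) h refl = ⊥-elim (hits-differ l s h refl)
  hits-unique (l , just s)  (l′ , just s′) h h′ with refl ← hits-same-line s s′ h h′ = cong (λ b → l , just b) (same s s′ h h′)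
    where
    same : ∀ s s′ → Hits _ (l , just s) _ → Hits _ (l , just s′) _ → s ≡ s′
    same true  true  _ _ = refl
    same false false _ _ = refl
    same true  false h h′ = ⊥-elim (ahead-asym (shift⇒ahead h) (shift⇒ahead h′))
    same false true  h h′ = ⊥-elim (ahead-asym (shift⇒ahead h′) (shift⇒ahead h))

  directions : List (Maybe Bool)
  directions = nothing ∷ just true ∷ just false ∷ []

  allItems : List Item
  allItems = cartesianProduct (allFin d) directions

  ∈-allItems : ∀ it → it ∈ allItems
  ∈-allItems (l , κ) = ∈-cartesianProduct⁺ (∈-allFin l) (∈-directions κ)
    where
    ∈-directions : ∀ κ → κ ∈ directions
    ∈-directions nothing      = here refl
    ∈-directions (just true)  = there (here refl)
    ∈-directions (just false) = there (there (here refl))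

  allItems-unique : Unique allItems
  allItems-unique = Unique.cartesianProduct⁺ (Unique.allFin⁺ d)
    (((λ ()) ∷ (λ ()) ∷ []) ∷ ((λ ()) ∷ []) ∷ [] ∷ [])

-- Terminals, substitutes and disjoint arms

module Linkage (d T m : ℕ) .{{_ : NonZero m}} (wide : T + T + (T + T) < m) (3≤d : 3 ≤ d) where

  open Lattice d T m wide

  record Terminals : Set where
    field
      M     : ℕ
      u     : Fin M → Vertex
      u-inj : Injective _≡_ _≡_ u
      roomy : M * d + M * 3 ≤ T
      crowd : ∀ Q (ks : List (Fin M)) → Unique ks → (∀ {i} → i ∈ ks → ∃ λ it → Hits Q it (u i)) → length ks ≤ d

  module Exits (terminals : Terminals) where

    open Terminals terminals public

    Q : Fin M → Point
    Q i = proj₁ (u i)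

    J : Fin M → Fin d
    J i = proj₂ (u i)

    Hit : Point → Item → Set
    Hit P it = ∃ λ i → Hits P it (u i)

    Hit? : ∀ P → Decidable (Hit P)
    Hit? P it = F.any? λ i → Hits? P it (u i)

    items : Point → List Item
    items P = filter (Hit? P) allItems

    items-unique : ∀ P → Unique (items P)
    items-unique P = Unique.filter⁺ (Hit? P) allItems-unique

    ∈-items : ∀ {P it} → Hit P it → it ∈ items P
    ∈-items {P} h = ∈-filter⁺ (Hit? P) (∈-allItems _) h

    -- By `hits-unique`, different hit items are hit by different terminals, so `crowd` bounds their
    -- number.
    items-short : ∀ P → length (items P) ≤ d
    items-short P = subst (_≤ d) (length-tabulate owner)
      (crowd P (tabulate owner) (Unique.tabulate⁺ owner-inj) owned)
      where
      hit : ∀ a → Hit P (lookup (items P) a)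
      hit a = proj₂ (∈-filter⁻ (Hit? P) {xs = allItems} (∈-lookup {xs = items P} a))
      owner : Fin (length (items P)) → Fin M
      owner a = proj₁ (hit a)
      owner-inj : Injective _≡_ _≡_ owner
      owner-inj {a} {b} eq = lookup-injective (items-unique P)
        (hits-unique _ _ (proj₂ (hit a)) (subst (λ i → Hits P (lookup (items P) b) (u i)) (sym eq) (proj₂ (hit b))))
      owned : ∀ {i} → i ∈ tabulate owner → ∃ λ it → Hits P it (u i)
      owned i∈ with a , refl ← ∈-tabulate⁻ i∈ = _ , proj₂ (hit a)

    -- These are the terminal directions in need of a substitute vertex.
    Redundant : Point → Item → Set
    Redundant P (l , nothing) = ⊥
    Redundant P (l , just _)  = Hit P (l , nothing)

    Redundant? : ∀ P → Decidable (Redundant P)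
    Redundant? P (l , nothing) = no λ ()
    Redundant? P (l , just _)  = Hit? P (l , nothing)

    redundant : Point → List Item
    redundant P = filter (Redundant? P) (items P)

    forbidden : Point → List (Fin d)
    forbidden P = map proj₁ (filter (¬? ∘ Redundant? P) (items P))

    -- The hit items split into redundant and other ones, at most `d` in all. So the `d` indices,
    -- less those in `forbidden`, still provide a separate one for every redundant item.
    substitutes : ∀ P → Σ (Fin (length (redundant P)) → Fin d) λ c → (∀ a → c a ∉ forbidden P) × Injective _≡_ _≡_ c
    substitutes P = avoid-distinctly F._≟_ {f = λ _ → id} (λ _ → id) (forbidden P)
      (subst (_≤ d) (sym (trans (cong (_+ length (redundant P)) (length-map proj₁ (filter (¬? ∘ Redundant? P) (items P))))
        (length-filter-split (Redundant? P) (items P)))) (items-short P))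

    Substitute : Point → Fin d → Bool → Fin d → Set
    Substitute P j σ l = Σ ((j , just σ) ∈ redundant P) λ p → l ≡ proj₁ (substitutes P) (index p)

    substitute-injective : ∀ {P j j′ σ σ′ l} → Substitute P j σ l → Substitute P j′ σ′ l → j ≡ j′ × σ ≡ σ′
    substitute-injective {P} (p , refl) (p′ , eq)
      with refl ← index-injective p p′ (proj₂ (proj₂ (substitutes P)) eq) = refl , refl

    -- A redundant direction comes with a hit vertex item of the same index, which is itself not
    -- redundant. So `forbidden` covers every index that carries a hit item.
    substitute-clear : ∀ {P j σ l} → Substitute P j σ l → ∀ κ → ¬ Hit P (l , κ)
    substitute-clear {P} {l = l} (p , refl) κ h with Redundant? P (l , κ)
    ... | no ¬r = proj₁ (proj₂ (substitutes P)) (index p)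
                    (∈-map⁺ proj₁ (∈-filter⁺ (¬? ∘ Redundant? P) (∈-items h) ¬r))
    substitute-clear {P} {l = l} (p , refl) (just _) h | yes r =
      proj₁ (proj₂ (substitutes P)) (index p)
        (∈-map⁺ proj₁ (∈-filter⁺ (¬? ∘ Redundant? P) (∈-items r) λ ()))

    record Exit (i : Fin M) (σ : Bool) : Set where
      field
        l     : Fin d
        s     : Bool
        clear : ¬ Hit (Q i) (l , just s)
        kind  : (l ≡ J i × s ≡ σ) ⊎ Substitute (Q i) (J i) σ l

    terminal-hit : ∀ i → Hit (Q i) (J i , nothing)
    terminal-hit i = i , refl

    exit : ∀ i σ → Exit i σ
    exit i σ with Hit? (Q i) (J i , just σ)
    ... | no ¬h = record { clear = ¬h ; kind = inj₁ (refl , refl) }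
    -- The line of a substitute is clear both ways; forward is an arbitrary choice.
    ... | yes h = record { s = true ; clear = substitute-clear sub (just true) ; kind = inj₂ sub }
      where
      sub : Substitute (Q i) (J i) σ _
      sub = ∈-filter⁺ (Redundant? (Q i)) (∈-items h) (terminal-hit i) , refl

    module _ (i : Fin M) (σ : Bool) where
      open Exit (exit i σ) public using () renaming (l to out; s to dir; clear to exit-clear; kind to exit-kind)

    OnRay : Fin M → Bool → Vertex → Set
    OnRay i σ (X , a) = a ≡ out i σ × ∃ λ t → ∃ λ y → t ≤ T ×
      X ≡ Q i [ out i σ ]≔ y × On (Q i ! out i σ) (dir i σ) t y

    -- An arm on the terminal's own line starts just after the terminal; an arm through a substitute
    -- starts at the substitute vertex, its point with `t = 0`.
    Arm : Fin M → Bool → Vertex → Set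
    Arm i σ x = OnRay i σ x × x ≢ u i

    own-terminal : ∀ {i j l} → Q i ≡ Q j → l ≡ J j → ∀ {σ} → ¬ Substitute (Q i) (J i) σ l
    own-terminal {i} {j} Qi≡Qj refl sub = substitute-clear sub nothing (j , cong (_, J j) (sym Qi≡Qj))

    on-line : ∀ {P P′ : Point} {l y y′} → P [ l ]≔ y ≡ P′ [ l ]≔ y′ → P′ ≡ P [ l ]≔ (P′ ! l)
    on-line {P} {P′} {l} {y} {y′} eq = begin
      P′                               ≡⟨ Vec.[]≔-lookup P′ l ⟨
      P′ [ l ]≔ (P′ ! l)               ≡⟨ Vec.[]≔-idempotent P′ l ⟨
      (P′ [ l ]≔ y′) [ l ]≔ (P′ ! l)   ≡⟨ cong (_[ l ]≔ (P′ ! l)) eq ⟨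
      (P [ l ]≔ y) [ l ]≔ (P′ ! l)     ≡⟨ Vec.[]≔-idempotent P l ⟩
      P [ l ]≔ (P′ ! l)                ∎
      where open ≡-Reasoning

    -- A terminal met outside the clique of `u i` would hit the direction of the exit. Inside that
    -- clique the arm has at most a substitute vertex, which is not a terminal.
    arm-∉-terminals : ∀ {i σ x} → Arm i σ x → ∀ j → x ≢ u j
    arm-∉-terminals {i} {σ} {X , a} ((refl , t , y , t≤T , X≡ , on) , x≢) j x≡ with Q i ! out i σ F.≟ y
    ... | no c≢y = exit-clear i σ (j , toward⇒hits (dir i σ) (trans Qj≡ (cong (Q i [ out i σ ]≔_) (sym y≡)))
                     (subst (Toward (dir i σ) _) (sym y≡) (on⇒toward (dir i σ) c≢y t≤T on)))
      where
      Qj≡ : Q j ≡ Q i [ out i σ ]≔ y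
      Qj≡ = trans (sym (cong proj₁ x≡)) X≡
      y≡ : Q j ! out i σ ≡ y
      y≡ = trans (cong (_! out i σ) Qj≡) (≔-same (Q i) (out i σ))
    ... | yes refl with X≡Qi ← trans X≡ (Vec.[]≔-lookup (Q i) (out i σ)) | exit-kind i σ
    ...   | inj₁ (out≡J , _) = x≢ (cong₂ _,_ X≡Qi out≡J)
    ...   | inj₂ sub         = own-terminal {i} {j} (trans (sym X≡Qi) (cong proj₁ x≡)) (cong proj₂ x≡) sub

    private
      not-≢ : ∀ {σ σ′} → σ ≢ σ′ → σ′ ≡ Bool.not σ
      not-≢ {true}  {true}  ≢ᵇ = ⊥-elim (≢ᵇ refl)
      not-≢ {true}  {false} _  = refl
      not-≢ {false} {true}  _  = refl
      not-≢ {false} {false} ≢ᵇ = ⊥-elim (≢ᵇ refl)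

    own-arms-disjoint : ∀ {i σ σ′ x} → out i σ ≡ J i → dir i σ ≡ σ → out i σ′ ≡ J i → dir i σ′ ≡ σ′ →
                        Arm i σ x → Arm i σ′ x → σ ≡ σ′
    own-arms-disjoint {i} {σ} {σ′} out≡ dir≡ out′≡ dir′≡
      ((refl , t , y , t≤T , refl , on) , x≢) ((a≡ , t′ , y′ , t′≤T , X≡ , on′) , _)
      with σ Bool.≟ σ′
    ... | yes eq = eq
    ... | no σ≢σ′ = ⊥-elim (x≢ (cong₂ _,_ (trans (cong (Q i [ out i σ ]≔_) y≡c) (Vec.[]≔-lookup (Q i) _)) out≡))
      where
      y≡y′ : y ≡ y′
      y≡y′ = trans (sym (≔-same (Q i) _)) (trans (cong (_! out i σ) X≡)
               (trans (cong (λ o → (Q i [ out i σ′ ]≔ y′) ! o) a≡) (≔-same (Q i) _)))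
      on-opp : On (Q i ! out i σ) (Bool.not (dir i σ)) t′ y
      on-opp = subst₂ (λ b z → On (Q i ! out i σ) b t′ z)
        (trans dir′≡ (trans (not-≢ σ≢σ′) (cong Bool.not (sym dir≡)))) (sym y≡y′)
        (subst (λ o → On (Q i ! o) (dir i σ′) t′ y′) (sym a≡) on′)
      y≡c : y ≡ Q i ! out i σ
      y≡c = on-0 _ (dir i σ) (subst (λ n → On _ (dir i σ) n y) (on-opposite {s = dir i σ} t≤T t′≤T on on-opp) on)

    -- In one clique, terminals and substitutes all have separate indices, and the two ways along
    -- one line separate at the terminal. Arms from different cliques that meet share a line, and by
    -- `rays-meet` one of them heads for the clique of the other, against `clear`.
    arms-disjoint : ∀ {i j σ σ′ x} → Arm i σ x → Arm j σ′ x → i ≡ j × σ ≡ σ′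
    arms-disjoint {i} {j} {σ} {σ′} {X , a} A@((refl , t , y , t≤T , X≡ , on) , x≢) A′@((a≡ , t′ , y′ , t′≤T , X≡′ , on′) , x≢′)
      with Q i ≟ᴾ Q j
    ... | yes Qi≡Qj = same-clique (exit-kind i σ) (exit-kind j σ′)
      where
      same-clique : (out i σ ≡ J i × dir i σ ≡ σ) ⊎ Substitute (Q i) (J i) σ (out i σ) →
                    (out j σ′ ≡ J j × dir j σ′ ≡ σ′) ⊎ Substitute (Q j) (J j) σ′ (out j σ′) → i ≡ j × σ ≡ σ′
      same-clique (inj₁ (o , d≡)) (inj₁ (o′ , d≡′))
        with refl ← u-inj {i} {j} (cong₂ _,_ Qi≡Qj (trans (sym o) (trans a≡ o′)))
        = refl , own-arms-disjoint o d≡ o′ d≡′ A A′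
      same-clique (inj₁ (o , _)) (inj₂ sub) = ⊥-elim (own-terminal {j} {i} (sym Qi≡Qj) (trans (sym a≡) o) sub)
      same-clique (inj₂ sub) (inj₁ (o , _)) = ⊥-elim (own-terminal {i} {j} Qi≡Qj (trans a≡ o) sub)
      same-clique (inj₂ sub) (inj₂ sub′)
        with J≡ , σ≡ ← substitute-injective sub
               (subst₂ (λ P l → Substitute P (J j) σ′ l) (sym Qi≡Qj) (sym a≡) sub′)
        = u-inj (cong₂ _,_ Qi≡Qj J≡) , σ≡
    ... | no Qi≢Qj = ⊥-elim (conflict (rays-meet (dir i σ) (dir j σ′) c≢c′ t≤T t′≤T on on″))
      where
      l : Fin d
      l = out i σ
      X≡″ : X ≡ Q j [ l ]≔ y′
      X≡″ = subst (λ o → X ≡ Q j [ o ]≔ y′) (sym a≡) X≡′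
      y≡y′ : y′ ≡ y
      y≡y′ = trans (sym (≔-same (Q j) l)) (trans (cong (_! l) (trans (sym X≡″) X≡)) (≔-same (Q i) l))
      on″ : On (Q j ! l) (dir j σ′) t′ y
      on″ = subst₂ (λ o z → On (Q j ! o) (dir j σ′) t′ z) (sym a≡) y≡y′ on′
      line : Q j ≡ Q i [ l ]≔ (Q j ! l)
      line = on-line (trans (sym X≡) X≡″)
      line′ : Q i ≡ Q j [ l ]≔ (Q i ! l)
      line′ = on-line (trans (sym X≡″) X≡)
      c≢c′ : Q i ! l ≢ Q j ! l
      c≢c′ eq = Qi≢Qj (sym (trans line (trans (cong (Q i [ l ]≔_) (sym eq)) (Vec.[]≔-lookup (Q i) l))))
      conflict : Toward (dir i σ) (Q i ! l) (Q j ! l) ⊎ Toward (dir j σ′) (Q j ! l) (Q i ! l) → ⊥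
      conflict (inj₁ τ) = exit-clear i σ (j , toward⇒hits (dir i σ) line τ)
      conflict (inj₂ τ) = subst (λ o → ¬ Hit (Q j) (o , just (dir j σ′))) (sym a≡) (exit-clear j σ′)
                            (i , toward⇒hits (dir j σ′) line′ τ)

    arm-point : Fin M → Bool → ℕ → Vertex
    arm-point i σ t = Q i [ out i σ ]≔ ray (Q i ! out i σ) (dir i σ) t , out i σ

    arm-point-on : ∀ i σ {t} → t ≤ T → OnRay i σ (arm-point i σ t)
    arm-point-on i σ {t} t≤T = refl , t , _ , t≤T , refl , on-ray _ (dir i σ) (≤-trans t≤T T≤m)

    arm-edge : ∀ i σ {t} → t < T → E (arm-point i σ t) (arm-point i σ (suc t))
    arm-edge i σ {t} t<T = oriented (dir i σ)
      where
      c = Q i ! out i σ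
      oriented : ∀ s → E (Q i [ out i σ ]≔ ray c s t , out i σ) (Q i [ out i σ ]≔ ray c s (suc t) , out i σ)
      oriented true  = line-edge (Q i) (out i σ) (trans (cong (c ⊕_) (+-comm 1 t)) (sym (⊕-assoc c t 1)))
      oriented false = E-sym (line-edge (Q i) (out i σ)
        (trans (cong (c ⊕_) (trans (+-∸-assoc 1 (≤-trans t<T T≤m)) (+-comm 1 _))) (sym (⊕-assoc c (m ∸ suc t) 1))))

    arm-walk : ∀ {W : Vertex → Set} i σ {t₀} k → k + t₀ ≤ T → (∀ {t} → t₀ ≤ t → t ≤ T → W (arm-point i σ t)) →
               Star (Within W) (arm-point i σ t₀) (arm-point i σ (k + t₀))
    arm-walk i σ zero    _  _      = ε
    arm-walk i σ {t₀} (suc k) le inside =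
      arm-walk i σ k (<⇒≤ le) inside ◅◅
      (arm-edge i σ le , inside (m≤n+m t₀ k) (<⇒≤ le) , inside (m≤n+m t₀ (suc k)) le) ◅ ε

    -- The first step goes to the point with `t = 1` on the terminal's own line, or inside the
    -- clique to the substitute, the point with `t = 0`.
    leave : ∀ {W : Vertex → Set} i σ → (∀ {x} → Arm i σ x → W x) → ∀ {t} → suc t ≤ T →
            ∃ λ a → E (u i) a × W a × Star (Within W) a (arm-point i σ (suc t)) × W (arm-point i σ (suc t))
    leave {W} i σ inside {t} t<T = by-kind (exit-kind i σ)
      where
      by-kind : (out i σ ≡ J i × dir i σ ≡ σ) ⊎ Substitute (Q i) (J i) σ (out i σ) →
                ∃ λ a → E (u i) a × W a × Star (Within W) a (arm-point i σ (suc t)) × W (arm-point i σ (suc t))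
      by-kind (inj₁ (out≡J , _)) =
        arm-point i σ 1 , subst (λ x → E x (arm-point i σ 1)) start (arm-edge i σ 0<T) , W-point ≤-refl 0<T ,
        subst (λ n → Star (Within W) (arm-point i σ 1) (arm-point i σ n)) (+-comm t 1)
          (arm-walk i σ t (subst (_≤ T) (+-comm 1 t) t<T) W-point) ,
        W-point (s≤s z≤n) t<T
        where
        0<T : 0 < T
        0<T = ≤-trans (s≤s z≤n) t<T
        start : arm-point i σ 0 ≡ u i
        start = cong₂ _,_ (trans (cong (Q i [ out i σ ]≔_) (ray-0 _ (dir i σ))) (Vec.[]≔-lookup (Q i) _)) out≡J
        moved : ∀ {t} → 1 ≤ t → t ≤ T → arm-point i σ t ≢ u i
        moved {t} 1≤t t≤T eq = <⇒≢ 1≤t (sym (on-injective {s = dir i σ} (≤-<-trans t≤T T<m) (≤-<-trans z≤n T<m)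
          (subst (On _ (dir i σ) t) ray≡ (on-ray _ (dir i σ) (≤-trans t≤T T≤m)))
          (subst (On _ (dir i σ) 0) (ray-0 _ (dir i σ)) (on-ray _ (dir i σ) z≤n))))
          where
          ray≡ : ray (Q i ! out i σ) (dir i σ) t ≡ Q i ! out i σ
          ray≡ = trans (sym (≔-same (Q i) _)) (cong (λ x → proj₁ x ! out i σ) eq)
        W-point : ∀ {t} → 1 ≤ t → t ≤ T → W (arm-point i σ t)
        W-point 1≤t t≤T = inside (arm-point-on i σ t≤T , moved 1≤t t≤T)
      by-kind (inj₂ sub) =
        arm-point i σ 0 , inj₁ (start , out≢J ∘ sym) , W-point z≤n z≤n ,
        subst (λ n → Star (Within W) (arm-point i σ 0) (arm-point i σ n)) (+-identityʳ (suc t))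
          (arm-walk i σ (suc t) (subst (_≤ T) (sym (+-identityʳ (suc t))) t<T) W-point) ,
        W-point z≤n t<T
        where
        start : Q i ≡ Q i [ out i σ ]≔ ray (Q i ! out i σ) (dir i σ) 0
        start = sym (trans (cong (Q i [ out i σ ]≔_) (ray-0 _ (dir i σ))) (Vec.[]≔-lookup (Q i) _))
        out≢J : out i σ ≢ J i
        out≢J eq = own-terminal {i} {i} refl eq sub
        W-point : ∀ {t} → 0 ≤ t → t ≤ T → W (arm-point i σ t)
        W-point _ t≤T = inside (arm-point-on i σ t≤T , out≢J ∘ cong proj₂)

  module Links (terminals : Terminals) (π : Fin (Terminals.M terminals) → Fin (Terminals.M terminals))
               (π-inj : Injective _≡_ _≡_ π) where

    open Exits terminals

    old : List (Fin m)
    old = tabulate {n = M * d} λ a → Q (proj₁ (F.remQuot {M} d a)) ! proj₂ (F.remQuot {M} d a)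

    ∈-old : ∀ i j → Q i ! j ∈ old
    ∈-old i j = subst (_∈ old) (cong (λ p → Q (proj₁ p) ! proj₂ p) (F.remQuot-combine i j)) (∈-tabulate⁺ (F.combine i j))

    0<d : 0 < d
    0<d = ≤-trans (s≤s z≤n) 3≤d

    origin : Fin M → Fin 3 → Fin m × Bool
    origin n zero          = Q n ! out n true , dir n true
    origin n (suc zero)    = Q (π n) ! out (π n) false , dir (π n) false
    origin n (suc (suc _)) = Q n ! F.fromℕ< 0<d , true

    origin′ : Fin (M * 3) → Fin m × Bool
    origin′ a = origin (proj₁ (F.remQuot {M} 3 a)) (proj₂ (F.remQuot {M} 3 a))

    candidate : Fin (M * 3) → Fin T → Fin m
    candidate a t = ray (proj₁ (origin′ a)) (proj₂ (origin′ a)) (suc (toℕ t))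

    candidate-inj : ∀ a → Injective _≡_ _≡_ (candidate a)
    candidate-inj a {t} {t′} eq = F.toℕ-injective (suc-injective
      (on-injective {c} {s} (≤-<-trans (F.toℕ<n t) T<m) (≤-<-trans (F.toℕ<n t′) T<m)
        (on-ray c s (≤-trans (F.toℕ<n t) T≤m))
        (subst (On c s _) (sym eq) (on-ray c s (≤-trans (F.toℕ<n t′) T≤m)))))
      where
      c = proj₁ (origin′ a)
      s = proj₂ (origin′ a)

    choice : Σ (Fin (M * 3) → Fin T) λ c → (∀ a → candidate a (c a) ∉ old) × Injective _≡_ _≡_ (λ a → candidate a (c a))
    choice = avoid-distinctly F._≟_ candidate-inj old (subst (λ n → n + M * 3 ≤ T) (sym (length-tabulate _)) roomy)

    time : Fin M → Fin 3 → Fin T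
    time n b = proj₁ choice (F.combine n b)

    fresh : Fin M → Fin 3 → Fin m
    fresh n b = candidate (F.combine n b) (time n b)

    fresh≡ : ∀ n b → fresh n b ≡ ray (proj₁ (origin n b)) (proj₂ (origin n b)) (suc (toℕ (time n b)))
    fresh≡ n b = cong (λ p → ray (proj₁ (origin (proj₁ p) (proj₂ p))) (proj₂ (origin (proj₁ p) (proj₂ p)))
                               (suc (toℕ (time n b)))) (F.remQuot-combine n b)

    fresh∉old : ∀ n b → fresh n b ∉ old
    fresh∉old n b = proj₁ (proj₂ choice) (F.combine n b)

    fresh-inj : ∀ {n n′ b b′} → fresh n b ≡ fresh n′ b′ → n ≡ n′
    fresh-inj {n} {n′} {b} {b′} eq = proj₁ (F.combine-injective n b n′ b′ (proj₂ (proj₂ choice) eq))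

    Fresh Allowed : Fin M → Fin m → Set
    Fresh n c   = ∃ λ b → c ≡ fresh n b
    Allowed n c = c ∈ old ⊎ Fresh n c

    -- The value X ! i is ignored, so a middle region contains whole lines.
    record Middle (n : Fin M) (x : Vertex) : Set where
      constructor middle
      field
        some-fresh  : ∃ λ j → j ≢ proj₂ x × Fresh n (proj₁ x ! j)
        all-allowed : ∀ j → j ≢ proj₂ x → Allowed n (proj₁ x ! j)

    -- Shared by terminals and arms, since an arm changes only the coordinate of its own direction.
    -- It excludes every middle region.
    Old : Vertex → Set
    Old (X , i) = ∀ j → j ≢ i → X ! j ∈ old

    old-not-middle : ∀ {n} x → Old x → ¬ Middle n x
    old-not-middle _ o (middle (j , j≢i , b , eq) _) = fresh∉old _ b (subst (_∈ old) eq (o j j≢i))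

    terminal-old : ∀ i → Old (u i)
    terminal-old i j _ = ∈-old i j

    arm-old : ∀ {i σ} x → Arm i σ x → Old x
    arm-old {i} _ ((refl , _ , _ , _ , refl , _) , _) j j≢ = subst (_∈ old) (sym (≔-other (Q i) j≢)) (∈-old i j)

    -- The coordinate that is fresh for `n` must be allowed for `n′`; not being old, it is fresh for
    -- both links.
    middles-disjoint : ∀ {n n′ x} → Middle n x → Middle n′ x → n ≡ n′
    middles-disjoint (middle (j , j≢i , b , eq) _) (middle _ allowed) with allowed j j≢i
    ... | inj₁ o         = ⊥-elim (fresh∉old _ b (subst (_∈ old) eq o))
    ... | inj₂ (b′ , eq′) = fresh-inj (trans (sym eq) eq′)

    Region : Fin M → Vertex → Set
    Region n x = Arm n true x ⊎ Arm (π n) false x ⊎ Middle n x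

    region-∉-terminals : ∀ {n x} → Region n x → ∀ i → x ≢ u i
    region-∉-terminals (inj₁ A)        i = arm-∉-terminals A i
    region-∉-terminals (inj₂ (inj₁ A)) i = arm-∉-terminals A i
    region-∉-terminals (inj₂ (inj₂ B)) i refl = old-not-middle _ (terminal-old i) B

    regions-disjoint : ∀ {n n′ x} → Region n x → Region n′ x → n ≡ n′
    regions-disjoint (inj₁ A)        (inj₁ A′)        = proj₁ (arms-disjoint A A′)
    regions-disjoint (inj₁ A)        (inj₂ (inj₁ A′)) with () ← proj₂ (arms-disjoint A A′)
    regions-disjoint (inj₁ A)        (inj₂ (inj₂ B))  = ⊥-elim (old-not-middle _ (arm-old _ A) B)
    regions-disjoint (inj₂ (inj₁ A)) (inj₁ A′)        with () ← proj₂ (arms-disjoint A A′)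
    regions-disjoint (inj₂ (inj₁ A)) (inj₂ (inj₁ A′)) = π-inj (proj₁ (arms-disjoint A A′))
    regions-disjoint (inj₂ (inj₁ A)) (inj₂ (inj₂ B))  = ⊥-elim (old-not-middle _ (arm-old _ A) B)
    regions-disjoint (inj₂ (inj₂ B)) (inj₁ A)         = ⊥-elim (old-not-middle _ (arm-old _ A) B)
    regions-disjoint (inj₂ (inj₂ B)) (inj₂ (inj₁ A))  = ⊥-elim (old-not-middle _ (arm-old _ A) B)
    regions-disjoint (inj₂ (inj₂ B)) (inj₂ (inj₂ B′)) = middles-disjoint B B′

    module _ (n : Fin M) (h : Fin d) where

      z : Fin m
      z = fresh n (suc (suc zero))

      -- Holding coordinate `h` at `z` keeps every vertex of a direction other than `h` in the
      -- middle region while the remaining coordinates change.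
      record Good (X : Point) : Set where
        constructor good
        field
          at-h    : X ! h ≡ z
          allowed : ∀ j → Allowed n (X ! j)

      good⇒middle : ∀ {X i} → i ≢ h → Good X → Middle n (X , i)
      good⇒middle i≢h (good X!h≡z allowed) = middle (h , i≢h ∘ sym , suc (suc zero) , X!h≡z) λ j _ → allowed j

      good-≔ : ∀ {X Y} j → Good X → Good Y → Good (X [ j ]≔ (Y ! j))
      good-≔ {X} {Y} j (good X!h≡z X-ok) (good Y!h≡z Y-ok) =
        good (at h (_≡ z) X!h≡z Y!h≡z) λ i → at i (Allowed n) (X-ok i) (Y-ok i)
        where
        at : ∀ i (F : Fin m → Set) → F (X ! i) → F (Y ! i) → F ((X [ j ]≔ (Y ! j)) ! i)
        at i F p q with i F.≟ j
        ... | yes refl = subst F (sym (≔-same X j)) q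
        ... | no i≢j   = subst F (sym (≔-other X i≢j)) p

      line-ignored : ∀ {X i c} → Middle n (X , i) → Middle n (X [ i ]≔ c , i)
      line-ignored {X} (middle (j , j≢i , fr) allowed) = middle
        (j , j≢i , subst (Fresh n) (sym (≔-other X j≢i)) fr)
        λ k k≢i → subst (Allowed n) (sym (≔-other X k≢i)) (allowed k k≢i)

      along : ∀ {X} i → Middle n (X , i) → ∀ c → Star (Within (Middle n)) (X , i) (X [ i ]≔ c , i)
      along {X} i mid c = subst (λ Y → Star (Within (Middle n)) (Y , i) (X [ i ]≔ c , i)) (Vec.[]≔-lookup X i)
        (line-walk X i (λ _ → line-ignored mid) (X ! i) c)

      -- Coordinates are corrected one by one: a step in the clique to index `j`, a run along that
      -- line, and a step back to `i`. Those not in `js` agree already.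
      transit : ∀ {Y} i → i ≢ h → Good Y → ∀ js X → Good X → (∀ j → j ∈ js ⊎ X ! j ≡ Y ! j) →
                Star (Within (Middle n)) (X , i) (Y , i)
      transit {Y} i i≢h gY [] X gX rest =
        subst (λ P → Star (Within (Middle n)) (X , i) (P , i)) (lookup-ext (λ j → agree (rest j))) ε
        where
        agree : ∀ {j} → j ∈ [] ⊎ X ! j ≡ Y ! j → X ! j ≡ Y ! j
        agree (inj₂ eq) = eq
      transit {Y} i i≢h gY (j ∷ js) X gX rest = move ◅◅ transit i i≢h gY js X⁺ gX⁺ rest⁺
        where
        X⁺ : Point
        X⁺ = X [ j ]≔ (Y ! j)
        gX⁺ : Good X⁺
        gX⁺ = good-≔ {X} {Y} j gX gY
        rest⁺ : ∀ k → k ∈ js ⊎ X⁺ ! k ≡ Y ! k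
        rest⁺ k with k F.≟ j | rest k
        ... | yes refl | _                 = inj₂ (≔-same X j)
        ... | no k≢j   | inj₁ (here k≡j)   = ⊥-elim (k≢j k≡j)
        ... | no k≢j   | inj₁ (there k∈js) = inj₁ k∈js
        ... | no k≢j   | inj₂ eq           = inj₂ (trans (≔-other X k≢j) eq)
        move : Star (Within (Middle n)) (X , i) (X⁺ , i)
        move with j F.≟ h
        -- Coordinate `h` equals `z` at both points, so nothing has to move.
        ... | yes refl = subst (λ P → Star (Within (Middle n)) (X , i) (P , i))
                (sym (trans (cong (X [ j ]≔_) (trans (Good.at-h gY) (sym (Good.at-h gX)))) (Vec.[]≔-lookup X j))) ε
        ... | no j≢h = switch X i j (good⇒middle i≢h gX) (good⇒middle j≢h gX)
                   ◅◅ along j (good⇒middle j≢h gX) (Y ! j)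
                   ◅◅ switch X⁺ j i (good⇒middle j≢h gX⁺) (good⇒middle i≢h gX⁺)

    module _ (n : Fin M) where

      -- An end of the middle section: the point reached by an arm, off the line of h.
      record Gate (P : Point) (h : Fin d) : Set where
        field
          door    : Fin d
          door≢h  : door ≢ h
          opened  : Fresh n (P ! door)
          allowed : ∀ j → Allowed n (P ! j)

        at-gate : Middle n (P , h)
        at-gate = middle (door , door≢h , opened) λ j _ → allowed j

        raised : Point
        raised = P [ h ]≔ z n h

        raised-good : Good n h raised
        raised-good = good (≔-same P h) allowed′
          where
          allowed′ : ∀ j → Allowed n (raised ! j)
          allowed′ j with j F.≟ h
          ... | yes refl = inj₂ (suc (suc zero) , ≔-same P h)
          ... | no j≢h   = subst (Allowed n) (sym (≔-other P j≢h)) (allowed j)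

        -- While coordinate `h` changes, the fresh value at `door` keeps the walk in the middle
        -- region. Once it equals `z`, that value takes over and the walk may turn to index `door`.
        enter : Star (Within (Middle n)) (P , h) (raised , door)
        enter = along n h h at-gate (z n h) ◅◅
                switch raised h door (line-ignored n h at-gate) (good⇒middle n h door≢h raised-good)

      gate-walk : ∀ {P P′ h} → Gate P h → Gate P′ h → Star (Within (Middle n)) (P , h) (P′ , h)
      gate-walk {h = h} g g′ =
        G.enter ◅◅ transit n h G.door G.door≢h G′.raised-good (allFin d) G.raised G.raised-good (λ j → inj₁ (∈-allFin j)) ◅◅
        switch G′.raised G.door G′.door (good⇒middle n h G.door≢h G′.raised-good) (good⇒middle n h G′.door≢h G′.raised-good) ◅◅
        reverse (within-sym E-sym) G′.enter
        where
        module G  = Gate g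
        module G′ = Gate g′

      arm-gate : ∀ i σ b {h} → origin n b ≡ (Q i ! out i σ , dir i σ) → h ≢ out i σ →
                 Gate (proj₁ (arm-point i σ (suc (toℕ (time n b))))) h
      arm-gate i σ b orig h≢ = record
        { door    = out i σ
        ; door≢h  = h≢ ∘ sym
        ; opened  = b , value
        ; allowed = allowed
        }
        where
        P : Point
        P = proj₁ (arm-point i σ (suc (toℕ (time n b))))
        value : P ! out i σ ≡ fresh n b
        value = trans (≔-same (Q i) (out i σ))
          (sym (trans (fresh≡ n b) (cong (λ o → ray (proj₁ o) (proj₂ o) (suc (toℕ (time n b)))) orig)))
        allowed : ∀ j → Allowed n (P ! j)
        allowed j with j F.≟ out i σ
        ... | yes refl = inj₂ (b , value)
        ... | no j≢    = inj₁ (subst (_∈ old) (sym (≔-other (Q i) j≢)) (∈-old i j))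

      -- Three indices allow an `h` different from both exits, so that the fresh value at the end of
      -- either arm lies off the line of `h`.
      third : ∃ λ h → h ∉ out n true ∷ out (π n) false ∷ []
      third = avoid F._≟_ {f = id} id _ 3≤d

      link : ∃ λ ps → Chain (u n) ps (u (π n)) × All (Region n) ps × Unique ps
      link
        with h , h∉ ← third
        with a , u~a , Wa , out-walk , W-out ← leave {Region n} n true inj₁ (F.toℕ<n (time n zero))
        with b , u~b , Wb , in-walk , W-in ← leave {Region n} (π n) false (inj₂ ∘ inj₁) (F.toℕ<n (time n (suc zero)))
        with gate ← arm-gate n true zero refl (λ eq → h∉ (here eq))
        with gate′ ← arm-gate (π n) false (suc zero) refl (λ eq → h∉ (there (here eq)))
        = loop-erase u~a Wa
            ( out-walk
            ◅◅ (inj₁ (refl , λ eq → h∉ (here (sym eq))) , W-out , inj₂ (inj₂ (Gate.at-gate gate))) ◅ ε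
            ◅◅ Star.map (λ (e , p , q) → e , inj₂ (inj₂ p) , inj₂ (inj₂ q)) (gate-walk gate gate′)
            ◅◅ (inj₁ (refl , λ eq → h∉ (there (here eq))) , inj₂ (inj₂ (Gate.at-gate gate′)) , W-in) ◅ ε
            ◅◅ reverse (within-sym E-sym) in-walk )
            (E-sym u~b)

    abstract
      linkage : Σ (Fin M → List Vertex) λ p →
        (∀ n → Chain (u n) (p n) (u (π n))) × (∀ n → Unique (p n)) ×
        (∀ i n → u i ∉ p n) × (∀ {n n′} → n ≢ n′ → Disjoint (p n) (p n′))
      linkage = (λ n → proj₁ (link n)) , (λ n → proj₁ (proj₂ (link n))) , (λ n → proj₂ (proj₂ (proj₂ (link n)))) ,
        (λ i n u∈p → region-∉-terminals (inside u∈p) i refl) ,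
        λ n≢n′ (x∈p , x∈p′) → n≢n′ (regions-disjoint (inside x∈p) (inside x∈p′))
        where
        inside : ∀ {n x} → x ∈ proj₁ (link n) → Region n x
        inside {n} = All.lookup (proj₁ (proj₂ (proj₂ (link n))))

-- Repetition-free lists and the cyclic successor

module _ {A : Set} where

  unique-⊑ : {xs ys : List A} → xs ⊑ ys → Unique ys → Unique xs
  unique-⊑ []         []       = []
  unique-⊑ (_ ∷ʳ s)   (_ ∷ u)  = unique-⊑ s u
  unique-⊑ (refl ∷ s) (p ∷ u)  = Sub.All-resp-⊆ s p ∷ unique-⊑ s u

  unique-rotate : (xs ys : List A) → Unique (xs ++ ys) → Unique (ys ++ xs)
  unique-rotate xs ys = Permutation.Unique-resp-↭ (setoid A) (Permutation.++-comm (setoid A) xs ys)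

  ∉-∷ : ∀ {x y : A} {zs} → x ≢ y → x ∉ zs → x ∉ y ∷ zs
  ∉-∷ x≢y _   (here p)  = x≢y p
  ∉-∷ _   x∉ (there p) = x∉ p

  ∉-∷ʳ : ∀ {x y : A} zs → x ∉ zs → x ≢ y → x ∉ zs ++ y ∷ []
  ∉-∷ʳ zs x∉ x≢y p with ∈-++⁻ zs p
  ... | inj₁ q        = x∉ q
  ... | inj₂ (here q) = x≢y q

  unique-between : ∀ {x y : A} {zs} → Unique zs → x ∉ zs → y ∉ zs → x ≢ y → Unique (x ∷ zs ++ y ∷ [])
  unique-between {x} {y} {zs} u x∉ y∉ x≢y =
    All.¬Any⇒All¬ _ (∉-∷ʳ zs x∉ x≢y) ∷ Unique.++⁺ u ([] ∷ []) λ { (p , here refl) → y∉ p }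

  lookup-last : ∀ x (zs : List A) {y} → lookup (x ∷ zs ++ y ∷ []) (fromℕ (length (zs ++ y ∷ []))) ≡ y
  lookup-last x []       = refl
  lookup-last x (z ∷ zs) = lookup-last z zs

  all-just : (xs : List (Maybe A)) → nothing ∉ xs → ∃ λ ys → xs ≡ map just ys
  all-just []             _ = [] , refl
  all-just (just x ∷ xs)  ∉ with ys , refl ← all-just xs (∉ ∘ there) = x ∷ ys , refl
  all-just (nothing ∷ xs) ∉ = ⊥-elim (∉ (here refl))

  unique-map⁻ : ∀ {B : Set} {f : A → B} {xs} → Unique (map f xs) → Unique xs
  unique-map⁻ {xs = []}     _       = []
  unique-map⁻ {f = f} {xs = x ∷ xs} (p ∷ u) = All.map (λ fx≢ eq → fx≢ (cong f eq)) (All.map⁻ p) ∷ unique-map⁻ u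

next : ∀ {n} → Fin (suc n) → Fin (suc n)
next i with view i
... | ‵fromℕ     = zero
... | ‵inject₁ j = suc j

next-inject₁ : ∀ {n} (i : Fin n) → next (inject₁ i) ≡ suc i
next-inject₁ i rewrite view-inject₁ i = refl

next-fromℕ : ∀ n → next (fromℕ n) ≡ zero
next-fromℕ n rewrite view-fromℕ n = refl

next-injective : ∀ {n} → Injective _≡_ _≡_ (next {n})
next-injective {x = i} {j} eq with view i | view j
... | ‵fromℕ     | ‵fromℕ     = refl
... | ‵inject₁ i | ‵inject₁ j = cong inject₁ (F.suc-injective eq)

-- The graph with a hub and its cycles

module HubGraph (e T m : ℕ) .{{_ : NonZero m}} (wide : T + T + (T + T) < m)
                (roomy : (4 + e) * (3 + e) + (4 + e) * 3 ≤ T) (spokes : 2 + e ≤ m) where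

  d : ℕ
  d = 3 + e

  3≤d : 3 ≤ d
  3≤d = s≤s (s≤s (s≤s z≤n))

  open Lattice d T m wide
  open Linkage d T m wide 3≤d using (Terminals; module Links)

  -- nothing is the hub.
  V : Set
  V = Maybe Vertex

  _≟ⱽ_ : DecidableEquality V
  _≟ⱽ_ = Maybe.≡-dec _≟ᵛ_

  spoke : Fin (2 + e) → Vertex
  spoke c = replicate d (F.inject≤ c spokes) , zero

  A : V → V → Set
  A nothing  nothing  = ⊥
  A nothing  (just y) = ∃ λ c → y ≡ spoke c
  A (just x) nothing  = ∃ λ c → x ≡ spoke c
  A (just x) (just y) = E x y

  module W = Walks _≟ⱽ_ A

  just-chain : ∀ {x y} ps → Chain x ps y → W.Chain (just x) (map just ps) (just y)
  just-chain []       x~y     = x~y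
  just-chain (_ ∷ ps) (e , c) = e , just-chain ps c

  spoke-agree : ∀ {c c′ i} → proj₁ (spoke c) ! i ≡ proj₁ (spoke c′) ! i → c ≡ c′
  spoke-agree {c} {c′} {i} eq = F.inject≤-injective spokes spokes c c′
    (trans (sym (Vec.lookup-replicate i _)) (trans eq (Vec.lookup-replicate i _)))

  spoke-injective : Injective _≡_ _≡_ spoke
  spoke-injective eq = spoke-agree {i = zero} (cong (λ x → proj₁ x ! zero) eq)

  -- Off the two lines concerned there is a third coordinate, in which both spokes agree with `Q`;
  -- constant points that agree in one coordinate are equal.
  spokes-apart : ∀ {Q c c′} it it′ → Hits Q it (spoke c) → Hits Q it′ (spoke c′) → c ≡ c′
  spokes-apart it it′ h h′
    with i , i∉ ← avoid F._≟_ {f = id} id (proj₁ it ∷ proj₁ it′ ∷ []) 3≤d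
    = spoke-agree {i = i} (trans (hits-agree it h i (i∉ ∘ here)) (sym (hits-agree it′ h′ i (i∉ ∘ there ∘ here))))

  Crowd : List Vertex → Set
  Crowd us = ∀ Q (ks : List (Fin (length us))) → Unique ks →
             (∀ {i} → i ∈ ks → ∃ λ it → Hits Q it (lookup us i)) → length ks ≤ d

  unique-length : ∀ {n} {ks : List (Fin n)} → Unique ks → length ks ≤ n
  unique-length {n} {ks} u = subst (length ks ≤_) (length-tabulate {n = n} id) (unique-⊆⇒length-≤ u λ _ → ∈-allFin _)

  few-crowd : ∀ {us} → length us ≤ d → Crowd us
  few-crowd short _ _ u _ = ≤-trans (unique-length u) short

  -- By `spokes-apart` one of the two spokes does not hit `Q`, which leaves at most `d` of the up to
  -- `d + 1` terminals.
  spokes-crowd : ∀ {us c c′} → length us ≤ suc d → c ≢ c′ → spoke c ∈ us → spoke c′ ∈ us → Crowd us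
  spokes-crowd {us} {c} {c′} short c≢c′ c∈ c′∈ Q ks u hits = pick (index c∈ ∈? ks) (index c′∈ ∈? ks)
    where
    open DecMembership (F._≟_ {length us}) using (_∈?_)
    missing : ∀ {i} → i ∉ ks → length ks ≤ d
    missing i∉ = s≤s⁻¹ (≤-trans (unique-length (All.¬Any⇒All¬ ks i∉ ∷ u)) short)
    pick : Dec (index c∈ ∈ ks) → Dec (index c′∈ ∈ ks) → length ks ≤ d
    pick (no i∉) _       = missing i∉
    pick _       (no i∉) = missing i∉
    pick (yes p) (yes q) with it , h ← hits p | it′ , h′ ← hits q =
      ⊥-elim (c≢c′ (spokes-apart it it′ (subst (Hits Q it) (sym (lookup-index c∈)) h)
                                         (subst (Hits Q it′) (sym (lookup-index c′∈)) h′)))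

  -- The bound `suc d` allows for a hub among the `d` given vertices: the other `d ∸ 1` are then
  -- joined by up to two spokes.
  terminals : ∀ us → Unique us → length us ≤ suc d → Crowd us → Terminals
  terminals us u! short crowd = record
    { M = length us ; u = lookup us ; u-inj = lookup-injective u!
    ; roomy = ≤-trans (+-mono-≤ (*-monoˡ-≤ d short) (*-monoˡ-≤ 3 short)) roomy
    ; crowd = crowd }

  CycleThrough : List V → Set
  CycleThrough vs = ∃ λ c → W.Closed c × Unique c × vs ⊑ c

  just-∉ : ∀ {x : Vertex} {xs} → x ∉ xs → just x ∉ map just xs
  just-∉ x∉ p with y , y∈ , refl ← ∈-map⁻ just p = x∉ y∈

  just-disjoint : ∀ {xs ys : List Vertex} → Disjoint xs ys → Disjoint (map just xs) (map just ys)
  just-disjoint # (p , q) with x , x∈ , refl ← ∈-map⁻ just p | y , y∈ , refl ← ∈-map⁻ just q = # (x∈ , y∈)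

  just-lookup : ∀ (us : List Vertex) → tabulate (just ∘ lookup us) ≡ map just us
  just-lookup us = trans (sym (map-tabulate (lookup us) just)) (cong (map just) (tabulate-lookup us))

  module _ (x : Vertex) (us : List Vertex) (u! : Unique (x ∷ us)) (short : length (x ∷ us) ≤ suc d)
           (crowd : Crowd (x ∷ us)) where

    private
      u : Fin (suc (length us)) → V
      u i = just (lookup (x ∷ us) i)
      u-inj : Injective _≡_ _≡_ u
      u-inj eq = lookup-injective u! (Maybe.just-injective eq)
      links = Links.linkage (terminals (x ∷ us) u! short crowd) next next-injective
      p : Fin (suc (length us)) → List Vertex
      p = proj₁ links
      chains : ∀ i → W.Chain (u i) (map just (p i)) (u (next i))
      chains i = just-chain (p i) (proj₁ (proj₂ links) i)
      p! : ∀ i → Unique (map just (p i))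
      p! i = Unique.map⁺ Maybe.just-injective (proj₁ (proj₂ (proj₂ links)) i)
      u∉p : ∀ i j → u i ∉ map just (p j)
      u∉p i j = just-∉ (proj₁ (proj₂ (proj₂ (proj₂ links))) i j)
      p# : ∀ {i j} → i ≢ j → Disjoint (map just (p i)) (map just (p j))
      p# i≢j = just-disjoint (proj₂ (proj₂ (proj₂ (proj₂ links))) i≢j)
      step : ∀ i → W.Chain (u (inject₁ i)) (map just (p (inject₁ i))) (u (suc i))
      step i = subst (λ j → W.Chain (u (inject₁ i)) (map just (p (inject₁ i))) (u j)) (next-inject₁ i) (chains (inject₁ i))

    lattice-cycle : CycleThrough (map just (x ∷ us))
    lattice-cycle = W.blocks u (map just ∘ p) ,
      W.chain-blocks (length us) u (map just ∘ p) (u zero) step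
        (subst (λ j → W.Chain (u (fromℕ _)) (map just (p (fromℕ _))) (u j)) (next-fromℕ (length us)) (chains (fromℕ _))) ,
      W.unique-blocks u-inj p! u∉p p# ,
      subst (λ vs → vs ⊑ W.blocks u (map just ∘ p)) (just-lookup (x ∷ us)) (W.⊑-blocks u (map just ∘ p))

    -- The link from the last terminal back to the first is dropped, and the cycle closes through
    -- the hub instead.
    hub-cycle : A nothing (just x) → A (u (fromℕ (length us))) nothing → CycleThrough (nothing ∷ map just (x ∷ us))
    hub-cycle hub~x last~hub = nothing ∷ W.blocks u q ,
      (hub~x , W.chain-blocks (length us) u q nothing
        (λ i → subst (λ l → W.Chain (u (inject₁ i)) l (u (suc i))) (sym (q-inject₁ i)) (step i))
        (subst (λ l → W.Chain (u (fromℕ _)) l nothing) (sym q-last) last~hub)) ,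
      All.¬Any⇒All¬ _ hub∉ ∷ W.unique-blocks u-inj q! (λ i j → u∉p i j ∘ q⊆p j) (λ i≢j (a , b) → p# i≢j (q⊆p _ a , q⊆p _ b)) ,
      refl ∷ subst (λ vs → vs ⊑ W.blocks u q) (just-lookup (x ∷ us)) (W.⊑-blocks u q)
      where
      q : Fin (suc (length us)) → List V
      q i with view i
      ... | ‵fromℕ     = []
      ... | ‵inject₁ _ = map just (p i)
      q-inject₁ : ∀ i → q (inject₁ i) ≡ map just (p (inject₁ i))
      q-inject₁ i rewrite view-inject₁ i = refl
      q-last : q (fromℕ (length us)) ≡ []
      q-last rewrite view-fromℕ (length us) = refl
      q⊆p : ∀ i {y} → y ∈ q i → y ∈ map just (p i)
      q⊆p i y∈ with ‵inject₁ _ ← view i = y∈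
      q! : ∀ i → Unique (q i)
      q! i with view i
      ... | ‵fromℕ     = []
      ... | ‵inject₁ j = p! (inject₁ j)
      hub∉ : nothing ∉ W.blocks u q
      hub∉ h with block , h∈ , block∈ ← ∈-concat⁻′ (tabulate λ i → u i ∷ q i) h
             with i , refl ← ∈-tabulate⁻ {f = λ i → u i ∷ q i} block∈
             with h∈
      ... | there r with _ , _ , () ← ∈-map⁻ just (q⊆p i r)

  spoke-cycle : ∀ {c c′} zs → c ≢ c′ → Unique zs → spoke c ∉ zs → spoke c′ ∉ zs → length zs ≤ 2 + e →
    CycleThrough (nothing ∷ map just (spoke c ∷ zs ++ spoke c′ ∷ []))
  spoke-cycle {c} {c′} zs c≢c′ u c∉ c′∉ short =
    hub-cycle (spoke c) (zs ++ spoke c′ ∷ []) (unique-between u c∉ c′∉ (c≢c′ ∘ spoke-injective)) short⁺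
      (spokes-crowd short⁺ c≢c′ (here refl) (there (∈-++⁺ʳ zs (here refl))))
      (c , refl) (c′ , lookup-last (spoke c) zs)
    where
    short⁺ : length (spoke c ∷ zs ++ spoke c′ ∷ []) ≤ suc d
    short⁺ = s≤s (subst (_≤ d) (sym (trans (length-++ zs) (+-comm _ 1))) (s≤s short))

  through-⊑ : ∀ {vs ws} → vs ⊑ ws → CycleThrough ws → CycleThrough vs
  through-⊑ s (c , closed , u , t) = c , closed , u , Sub.⊆-trans s t

  -- At most e inner terminals are neighbours of the hub, so two of its 2 + e spokes remain.
  two-spokes : ∀ f inner g → f ≢ g → length inner ≤ e →
    ∃ λ a → ∃ λ b → a ≢ b × spoke a ∉ inner × spoke b ∉ inner × spoke a ≢ g × spoke b ≢ f
  two-spokes f inner g f≢g short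
    with c , c∉ ← avoid _≟ᵛ_ spoke-injective inner (s≤s (≤-trans short (n≤1+n e)))
    with c′ , c′∉ ← avoid _≟ᵛ_ spoke-injective (spoke c ∷ inner) (s≤s (s≤s short))
    with spoke c ≟ᵛ g | spoke c′ ≟ᵛ f
  -- `a` may coincide with `f` and `b` with `g`, but not crosswise; exchanging the two spokes
  -- repairs a crosswise coincidence.
  ... | yes refl | _        = c′ , c , (λ { refl → c′∉ (here refl) }) , c′∉ ∘ there , c∉ , c′∉ ∘ here , f≢g ∘ sym
  ... | no c≢g   | yes refl = c′ , c , (λ { refl → c′∉ (here refl) }) , c′∉ ∘ there , c∉ , f≢g , c′∉ ∘ here ∘ sym
  ... | no c≢g   | no c′≢f  = c , c′ , (λ { refl → c′∉ (here refl) }) , c∉ , c′∉ ∘ there , c≢g , c′≢f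

  -- A chosen spoke that equals the terminal beside the hub plays both parts. Otherwise it is
  -- inserted as an extra terminal and forgotten again by `through-⊑`.
  spokes-through : ∀ {f g a b} inner → Unique (f ∷ inner ++ g ∷ []) → length inner ≤ e →
    a ≢ b → spoke a ∉ inner → spoke b ∉ inner → spoke a ≢ g → spoke b ≢ f →
    Dec (spoke a ≡ f) → Dec (spoke b ≡ g) → CycleThrough (nothing ∷ map just (f ∷ inner ++ g ∷ []))
  spokes-through inner (_ ∷ u) short a≢b a∉ b∉ a≢g b≢f (yes refl) (yes refl) =
    spoke-cycle inner a≢b (unique-⊑ (Sub.++⁺ʳ _ Sub.⊆-refl) u) a∉ b∉ (≤-trans short (m≤n+m e 2))
  spokes-through inner (f∉ ∷ u) short a≢b a∉ b∉ a≢g b≢f (yes refl) (no b≢g) =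
    through-⊑ (refl ∷ Sub.map⁺ just (refl ∷ Sub.++⁺ʳ _ Sub.⊆-refl))
      (spoke-cycle (inner ++ _ ∷ []) a≢b u (All.All¬⇒¬Any f∉) (∉-∷ʳ inner b∉ b≢g)
        (subst (_≤ 2 + e) (sym (trans (length-++ inner) (+-comm _ 1))) (s≤s (≤-trans short (n≤1+n e)))))
  spokes-through {f} {a = a} inner u short a≢b a∉ b∉ a≢g b≢f (no a≢f) (yes refl) =
    through-⊑ (refl ∷ Sub.map⁺ just (spoke a ∷ʳ Sub.⊆-refl))
      (spoke-cycle (f ∷ inner) a≢b (unique-⊑ (refl ∷ Sub.++⁺ʳ _ Sub.⊆-refl) u)
        (∉-∷ a≢f a∉) (∉-∷ b≢f b∉) (s≤s (≤-trans short (n≤1+n e))))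
  spokes-through {f} {g} {a} inner u short a≢b a∉ b∉ a≢g b≢f (no a≢f) (no b≢g) =
    through-⊑ (refl ∷ Sub.map⁺ just (spoke a ∷ʳ Sub.++⁺ʳ _ Sub.⊆-refl))
      (spoke-cycle (f ∷ inner ++ g ∷ []) a≢b u (∉-∷ a≢f (∉-∷ʳ inner a∉ a≢g)) (∉-∷ b≢f (∉-∷ʳ inner b∉ b≢g))
        (s≤s (subst (_≤ 1 + e) (sym (trans (length-++ inner) (+-comm _ 1))) (s≤s short))))

  hub-through : ∀ f inner g → Unique (f ∷ inner ++ g ∷ []) → length inner ≤ e →
    CycleThrough (nothing ∷ map just (f ∷ inner ++ g ∷ []))
  hub-through f inner g u@(f∉ ∷ _) short =
    let a , b , a≢b , a∉ , b∉ , a≢g , b≢f = two-spokes f inner g (All.lookup f∉ (∈-++⁺ʳ inner (here refl))) short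
    in spokes-through inner u short a≢b a∉ b∉ a≢g b≢f (spoke a ≟ᵛ f) (spoke b ≟ᵛ g)

  -- Lets the hub be treated as the first terminal: the cycle is rotated together with the sequence.
  rotate-through : ∀ xs ys → CycleThrough (xs ++ ys) → CycleThrough (ys ++ xs)
  rotate-through xs ys (c , closed , u , s) with as , bs , refl , p , q ← ⊑-++⁻ xs s =
    bs ++ as , W.closed-rotate as bs closed , unique-rotate as bs u , Sub.++⁺ q p

  cycle-through : ∀ vs → Unique vs → length vs ≡ d → CycleThrough vs
  cycle-through vs u len with nothing ∈? vs
    where open DecMembership _≟ⱽ_ using (_∈?_)
  ... | no hub∉ with all-just vs hub∉
  ...   | x ∷ us , refl = lattice-cycle x us (unique-map⁻ u) (≤-trans (≤-reflexive length≡) (n≤1+n d))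
                            (few-crowd {x ∷ us} (≤-reflexive length≡))
    where
    length≡ : length (x ∷ us) ≡ d
    length≡ = trans (sym (length-map just (x ∷ us))) len
  cycle-through vs u len | yes hub∈ with pre , post , refl ← ∈-∃++ hub∈ =
    rotate-through (nothing ∷ post) pre (from-rest (post ++ pre) rest! rest-length)
    where
    rest! : Unique (nothing ∷ post ++ pre)
    rest! = unique-rotate pre (nothing ∷ post) u
    rest-length : length (post ++ pre) ≡ 2 + e
    rest-length = suc-injective (trans (length-++-comm (nothing ∷ post) pre) len)
    from-rest : ∀ rest → Unique (nothing ∷ rest) → length rest ≡ 2 + e → CycleThrough (nothing ∷ rest)
    from-rest rest (hub∉ ∷ u) len with all-just rest (All.All¬⇒¬Any hub∉)
    -- At least two terminals remain besides the hub; the first and the last of them are next to it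
    -- in the cyclic order.
    ... | f ∷ tail , refl with initLast tail
    ...   | inner ∷ʳ′ g = hub-through f inner g (unique-map⁻ u) (≤-reflexive (suc-injective (suc-injective (begin
      suc (suc (length inner))                   ≡⟨ cong suc (+-comm 1 (length inner)) ⟩
      suc (length inner + 1)                     ≡⟨ cong suc (length-++ inner) ⟨
      length (f ∷ inner ++ g ∷ [])               ≡⟨ length-map just (f ∷ inner ++ g ∷ []) ⟨
      length (map just (f ∷ inner ++ g ∷ []))    ≡⟨ len ⟩
      suc (suc e)                                ∎))))
      where open ≡-Reasoning

-- Numbering the vertices

vec↔fin : ∀ m n → Vec (Fin m) n ↔ Fin (m ^ n)
vec↔fin m n = mk↔ₛ′ encode decode (encode-decode n) decode-encode
  where
  encode : ∀ {n} → Vec (Fin m) n → Fin (m ^ n)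
  encode []       = zero
  encode (x ∷ xs) = F.combine x (encode xs)
  decode : ∀ {n} → Fin (m ^ n) → Vec (Fin m) n
  decode {zero}  _ = []
  decode {suc n} i = proj₁ (F.remQuot (m ^ n) i) ∷ decode (proj₂ (F.remQuot {m} (m ^ n) i))
  encode-decode : ∀ n (i : Fin (m ^ n)) → encode (decode {n} i) ≡ i
  encode-decode zero    zero = refl
  encode-decode (suc n) i    = trans (cong (F.combine (proj₁ (F.remQuot {m} (m ^ n) i))) (encode-decode n _))
                                     (F.combine-remQuot {m} (m ^ n) i)
  decode-encode : ∀ {n} (xs : Vec (Fin m) n) → decode (encode xs) ≡ xs
  decode-encode []       = refl
  decode-encode (x ∷ xs) = trans (cong (λ p → proj₁ p ∷ decode (proj₂ p)) (F.remQuot-combine x (encode xs)))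
                                 (cong (x ∷_) (decode-encode xs))

maybe↔fin : ∀ {A B : Set} {a b} → A ↔ Fin a → B ↔ Fin b → Maybe (A × B) ↔ Fin (suc (a * b))
maybe↔fin {A} {B} {a} {b} f g = mk↔ₛ′ encode decode encode-decode decode-encode
  where
  module f = Inverse f
  module g = Inverse g
  encode : Maybe (A × B) → Fin (suc (a * b))
  encode nothing        = zero
  encode (just (x , y)) = suc (F.combine (f.to x) (g.to y))
  decode : Fin (suc (a * b)) → Maybe (A × B)
  decode zero    = nothing
  decode (suc i) = just (f.from (proj₁ (F.remQuot {a} b i)) , g.from (proj₂ (F.remQuot {a} b i)))
  encode-decode : ∀ i → encode (decode i) ≡ i
  encode-decode zero    = refl
  encode-decode (suc i) = cong suc (trans (cong₂ F.combine (f.strictlyInverseˡ _) (g.strictlyInverseˡ _)) (F.combine-remQuot {a} b i))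
  decode-encode : ∀ x → decode (encode x) ≡ x
  decode-encode nothing        = refl
  decode-encode (just (x , y)) =
    trans (cong (λ p → just (f.from (proj₁ p) , g.from (proj₂ p))) (F.remQuot-combine (f.to x) (g.to y)))
          (cong just (cong₂ _,_ (f.strictlyInverseʳ x) (g.strictlyInverseʳ y)))

-- Transfer to a `SimpleGraph`

module Enumerated {V : Set} (_≟_ : DecidableEquality V) {A : V → V → Set} (A? : ∀ x y → Dec (A x y))
                  (A-sym : Symmetric A) (A-irrefl : ∀ x → ¬ A x x) {n} (V↔Fin : V ↔ Fin n) where

  open Inverse V↔Fin using (to; from; strictlyInverseˡ; strictlyInverseʳ)
  module W = Walks _≟_ A

  from-injective : Injective _≡_ _≡_ from
  from-injective {i} {j} eq = trans (sym (strictlyInverseˡ i)) (trans (cong to eq) (strictlyInverseˡ j))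

  to-injective : Injective _≡_ _≡_ to
  to-injective {x} {y} eq = trans (sym (strictlyInverseʳ x)) (trans (cong from eq) (strictlyInverseʳ y))

  graph : SimpleGraph n
  graph = record
    { adj    = λ i j → ⌊ A? (from i) (from j) ⌋
    ; sym    = λ i j → symmetric (A? (from i) (from j)) (A? (from j) (from i))
    ; irrefl = λ i → irreflexive (A? (from i) (from i))
    }
    where
    symmetric : ∀ {x y} (p : Dec (A x y)) (q : Dec (A y x)) → ⌊ p ⌋ ≡ ⌊ q ⌋
    symmetric (yes _) (yes _) = refl
    symmetric (yes a) (no ¬a) = ⊥-elim (¬a (A-sym a))
    symmetric (no ¬a) (yes a) = ⊥-elim (¬a (A-sym a))
    symmetric (no _)  (no _)  = refl
    irreflexive : ∀ {x} (p : Dec (A x x)) → ⌊ p ⌋ ≡ false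
    irreflexive (yes a) = ⊥-elim (A-irrefl _ a)
    irreflexive (no _)  = refl

  adjacent⁺ : ∀ {i j} → A (from i) (from j) → Adj graph i j
  adjacent⁺ {i} {j} a with A? (from i) (from j)
  ... | yes _ = refl
  ... | no ¬a = ⊥-elim (¬a a)

  adjacent⁻ : ∀ {i j} → Adj graph i j → A (from i) (from j)
  adjacent⁻ {i} {j} _ with yes a ← A? (from i) (from j) = a

  to-adjacent : ∀ {x y} → A x y → Adj graph (to x) (to y)
  to-adjacent {x} {y} a = adjacent⁺ (subst₂ A (sym (strictlyInverseʳ x)) (sym (strictlyInverseʳ y)) a)

  to-chain : ∀ {x y} zs → W.Chain x zs y → Walks.Chain F._≟_ (Adj graph) (to x) (map to zs) (to y)
  to-chain []       a       = to-adjacent a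
  to-chain (_ ∷ zs) (a , c) = to-adjacent a , to-chain zs c

  to-closed : ∀ c → W.Closed c → Walks.Closed F._≟_ (Adj graph) (map to c)
  to-closed (x ∷ xs) = to-chain xs

  ordered : ∀ {r} → 3 ≤ r → (∀ vs → Unique vs → length vs ≡ r → ∃ λ c → W.Closed c × Unique c × vs ⊑ c) → Ordered r graph
  ordered 3≤r cycles v v-inj
    with c , closed , c! , s ← cycles (tabulate (from ∘ v)) (Unique.tabulate⁺ (v-inj ∘ from-injective)) (length-tabulate (from ∘ v))
    = closed⇒cycle graph v 3≤r (map to c) (to-closed c closed) (Unique.map⁺ to-injective c!)
        (subst (λ vs → vs ⊑ map to c) (trans (map-tabulate (from ∘ v) to) (tabulate-cong (strictlyInverseˡ ∘ v))) (Sub.map⁺ to s))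

  degree-≥′ : ∀ i {x ys a} → from i ≡ x → length ys ≡ a → Unique ys → (∀ {y} → y ∈ ys → A x y) → a ≤ degree graph i
  degree-≥′ i {ys = ys} refl refl u ok =
    subst (_≤ degree graph i) (length-map to ys) (degree-≥ graph (Unique.map⁺ to-injective u) ok′)
    where
    ok′ : ∀ {j} → j ∈ map to ys → Adj graph i j
    ok′ j∈ with y , y∈ , refl ← ∈-map⁻ to j∈ = adjacent⁺ (subst (A (from i)) (sym (strictlyInverseʳ y)) (ok y∈))

  degree-≤′ : ∀ i {x ys a} → from i ≡ x → length ys ≡ a → (∀ {y} → A x y → y ∈ ys) → degree graph i ≤ a
  degree-≤′ i {ys = ys} refl refl ok = subst (degree graph i ≤_) (length-map to ys)
    (degree-≤ graph λ {j} a → subst (_∈ map to ys) (strictlyInverseˡ j) (∈-map⁺ to (ok (adjacent⁻ a))))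

-- Degrees in the hub graph

module HubDegrees (e T m : ℕ) .{{_ : NonZero m}} (wide : T + T + (T + T) < m)
                  (roomy : (4 + e) * (3 + e) + (4 + e) * 3 ≤ T) (spokes : 2 + e ≤ m) where

  open HubGraph e T m wide roomy spokes
  open Lattice d T m wide

  2<m : 2 < m
  2<m = ≤-<-trans (≤-trans (s≤s (s≤s z≤n)) (≤-trans (m≤m+n ((4 + e) * (3 + e)) _) roomy)) T<m

  up≢ : ∀ X i → up X i ≢ X
  up≢ X i eq with () ← ⊕-moves 1 (<-trans ≤-refl 2<m) (trans (sym (≔-same X i)) (cong (_! i) eq))

  down : Point → Fin d → Point
  down X i = X [ i ]≔ (X ! i ⊕ (m ∸ 1))

  up-down : ∀ X i → X ≡ up (down X i) i
  up-down X i = sym (begin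
    up (down X i) i                              ≡⟨ Vec.[]≔-idempotent X i ⟩
    X [ i ]≔ (down X i ! i ⊕ 1)                  ≡⟨ cong (λ c → X [ i ]≔ (c ⊕ 1)) (≔-same X i) ⟩
    X [ i ]≔ (X ! i ⊕ (m ∸ 1) ⊕ 1)               ≡⟨ cong (X [ i ]≔_) (⊕-undo (X ! i) 1 (<⇒≤ (<-trans ≤-refl 2<m))) ⟩
    X [ i ]≔ (X ! i)                             ≡⟨ Vec.[]≔-lookup X i ⟩
    X                                            ∎)
    where open ≡-Reasoning

  down-unique : ∀ {X Y} i → X ≡ up Y i → Y ≡ down X i
  down-unique {X} {Y} i refl = sym (begin
    down (up Y i) i                              ≡⟨ Vec.[]≔-idempotent Y i ⟩
    Y [ i ]≔ (up Y i ! i ⊕ (m ∸ 1))              ≡⟨ cong (λ c → Y [ i ]≔ (c ⊕ (m ∸ 1))) (≔-same Y i) ⟩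
    Y [ i ]≔ (Y ! i ⊕ 1 ⊕ (m ∸ 1))               ≡⟨ cong (Y [ i ]≔_) round-trip ⟩
    Y [ i ]≔ (Y ! i)                             ≡⟨ Vec.[]≔-lookup Y i ⟩
    Y                                            ∎)
    where
    open ≡-Reasoning
    round-trip : Y ! i ⊕ 1 ⊕ (m ∸ 1) ≡ Y ! i
    round-trip = trans (⊕-assoc (Y ! i) 1 (m ∸ 1)) (trans (cong (Y ! i ⊕_) (m+[n∸m]≡n (<⇒≤ (<-trans ≤-refl 2<m)))) (⊕-m (Y ! i)))

  -- Equality would make two forward steps return to the start, although `m > 2`.
  up≢down : ∀ X i → up X i ≢ down X i
  up≢down X i eq = contradiction (⊕-moves 2 2<m two-steps) λ ()
    where
    open ≡-Reasoning
    two-steps : X ! i ⊕ 2 ≡ X ! i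
    two-steps = begin
      X ! i ⊕ 2                ≡⟨ ⊕-assoc (X ! i) 1 1 ⟨
      X ! i ⊕ 1 ⊕ 1            ≡⟨ cong (_⊕ 1) (trans (sym (≔-same X i)) (trans (cong (_! i) eq) (≔-same X i))) ⟩
      X ! i ⊕ (m ∸ 1) ⊕ 1      ≡⟨ ⊕-undo (X ! i) 1 (<⇒≤ (<-trans ≤-refl 2<m)) ⟩
      X ! i                    ∎

  down≢ : ∀ X i → down X i ≢ X
  down≢ X i eq = up≢ X i (trans (cong (λ Y → up Y i) (sym eq)) (sym (up-down X i)))

  mates : Vertex → List V
  mates (X , i) = map (λ j → just (X , punchIn i j)) (allFin (2 + e))

  -- The hub is listed for every lattice vertex, so this is an upper bound in general and the exact
  -- neighbourhood for a spoke.
  neighbours : Vertex → List V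
  neighbours x@(X , i) = nothing ∷ just (up X i , i) ∷ just (down X i , i) ∷ mates x

  mates-unique : ∀ x → Unique (mates x)
  mates-unique (X , i) = Unique.map⁺ (λ eq → F.punchIn-injective i _ _ (cong proj₂ (Maybe.just-injective eq)))
                                    (Unique.allFin⁺ (2 + e))

  length-mates : ∀ x → length (mates x) ≡ 2 + e
  length-mates (X , i) = trans (length-map _ (allFin (2 + e))) (length-tabulate {n = 2 + e} id)

  ∈-mates⁻ : ∀ {X i y} → y ∈ mates (X , i) → ∃ λ j → i ≢ j × y ≡ just (X , j)
  ∈-mates⁻ {X} {i} y∈ with j , _ , refl ← ∈-map⁻ (λ j → just (X , punchIn i j)) y∈ = punchIn i j , F.punchInᵢ≢i i j ∘ sym , refl

  mates-adjacent : ∀ x {y} → y ∈ mates x → A (just x) y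
  mates-adjacent x y∈ with j , i≢j , refl ← ∈-mates⁻ y∈ = inj₁ (refl , i≢j)

  neighbours-unique : ∀ x → Unique (neighbours x)
  neighbours-unique x@(X , i) =
    ((λ ()) ∷ (λ ()) ∷ All.tabulate not-hub) ∷
    ((up≢down X i ∘ cong proj₁ ∘ Maybe.just-injective) ∷ All.tabulate (not-mate (up≢ X i))) ∷
    All.tabulate (not-mate (down≢ X i)) ∷
    mates-unique x
    where
    not-hub : ∀ {y} → y ∈ mates x → nothing ≢ y
    not-hub y∈ with _ , _ , refl ← ∈-mates⁻ y∈ = λ ()
    not-mate : ∀ {Y} → Y ≢ X → ∀ {y} → y ∈ mates x → just (Y , i) ≢ y
    not-mate Y≢X y∈ with _ , _ , refl ← ∈-mates⁻ y∈ = Y≢X ∘ cong proj₁ ∘ Maybe.just-injective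

  adjacent⇒neighbour : ∀ x {y} → A (just x) y → y ∈ neighbours x
  adjacent⇒neighbour x {nothing} _ = here refl
  adjacent⇒neighbour (X , i) {just (_ , j)} (inj₁ (refl , i≢j)) =
    there (there (there (subst (λ k → just (X , k) ∈ mates (X , i)) (F.punchIn-punchOut i≢j)
      (∈-map⁺ (λ j → just (X , punchIn i j)) (∈-allFin (F.punchOut i≢j))))))
  adjacent⇒neighbour (X , i) {just (_ , .i)} (inj₂ (refl , inj₁ refl)) = there (here refl)
  adjacent⇒neighbour (X , i) {just (Y , .i)} (inj₂ (refl , inj₂ eq)) =
    there (there (here (cong (λ Z → just (Z , i)) (down-unique i eq))))

  spoke-neighbours : ∀ c {y} → y ∈ neighbours (spoke c) → A (just (spoke c)) y
  spoke-neighbours c (here refl)                 = c , refl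
  spoke-neighbours c (there (here refl))         = inj₂ (refl , inj₁ refl)
  spoke-neighbours c (there (there (here refl))) = inj₂ (refl , inj₂ (up-down _ zero))
  spoke-neighbours c (there (there (there y∈)))  = mates-adjacent (spoke c) y∈

  hub-neighbours : List V
  hub-neighbours = map (just ∘ spoke) (allFin (2 + e))

  hub-neighbours-unique : Unique hub-neighbours
  hub-neighbours-unique = Unique.map⁺ (spoke-injective ∘ Maybe.just-injective) (Unique.allFin⁺ (2 + e))

  length-hub-neighbours : length hub-neighbours ≡ 2 + e
  length-hub-neighbours = trans (length-map _ (allFin (2 + e))) (length-tabulate {n = 2 + e} id)

  hub-adjacent : ∀ {y} → y ∈ hub-neighbours → A nothing y
  hub-adjacent y∈ with c , _ , refl ← ∈-map⁻ (just ∘ spoke) y∈ = c , refl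

  adjacent⇒hub-neighbour : ∀ {y} → A nothing y → y ∈ hub-neighbours
  adjacent⇒hub-neighbour {just _} (c , refl) = ∈-map⁺ (just ∘ spoke) (∈-allFin c)

  A? : ∀ x y → Dec (A x y)
  A? nothing        nothing        = no λ ()
  A? nothing        (just y)       = F.any? λ c → y ≟ᵛ spoke c
  A? (just x)       nothing        = F.any? λ c → x ≟ᵛ spoke c
  A? (just (X , i)) (just (Y , j)) =
    (X ≟ᴾ Y ×-dec ¬? (i F.≟ j)) ⊎-dec (i F.≟ j ×-dec (Y ≟ᴾ up X i ⊎-dec X ≟ᴾ up Y i))

  A-sym : Symmetric A
  A-sym {nothing} {just _}  a = a
  A-sym {just _}  {nothing} a = a
  A-sym {just _}  {just _}  a = E-sym a

  A-irrefl : ∀ x → ¬ A x x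
  A-irrefl (just (X , i)) (inj₁ (_ , i≢i))        = i≢i refl
  A-irrefl (just (X , i)) (inj₂ (_ , inj₁ eq))    = up≢ X i (sym eq)
  A-irrefl (just (X , i)) (inj₂ (_ , inj₂ eq))    = up≢ X i (sym eq)

  V↔Fin : V ↔ Fin (suc (m ^ d * d))
  V↔Fin = maybe↔fin (vec↔fin m d) (mk↔ₛ′ id id (λ _ → refl) (λ _ → refl))

  open Enumerated _≟ⱽ_ A? A-sym A-irrefl V↔Fin
  open Inverse V↔Fin using (to; from; strictlyInverseʳ)

  hubGraph : SimpleGraph (suc (m ^ d * d))
  hubGraph = graph

  hubGraph-ordered : Ordered d hubGraph
  hubGraph-ordered = ordered 3≤d cycle-through

  -- For a lattice vertex the clique mates alone give the lower bound, and the list that includes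
  -- the hub gives the upper one.
  degree-bounds : ∀ i x → from i ≡ x → 2 + e ≤ degree graph i × degree graph i ≤ 5 + e
  degree-bounds i nothing eq =
    degree-≥′ i eq length-hub-neighbours hub-neighbours-unique hub-adjacent ,
    ≤-trans (degree-≤′ i eq length-hub-neighbours adjacent⇒hub-neighbour) (m≤n+m (2 + e) 3)
  degree-bounds i (just x) eq =
    degree-≥′ i eq (length-mates x) (mates-unique x) (mates-adjacent x) ,
    degree-≤′ i eq (cong (3 +_) (length-mates x)) (adjacent⇒neighbour x)

  hubGraph-min : HasMinDegree hubGraph (2 + e)
  -- Vertex `zero` is the hub, whose neighbours are exactly the `2 + e` spokes.
  hubGraph-min = (λ i → proj₁ (degree-bounds i (from i) refl)) , zero ,
    ≤-antisym (degree-≤′ zero refl length-hub-neighbours adjacent⇒hub-neighbour) (proj₁ (degree-bounds zero nothing refl))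

  hubGraph-max : HasMaxDegree hubGraph (5 + e)
  hubGraph-max = (λ i → proj₂ (degree-bounds i (from i) refl)) , i₀ ,
    ≤-antisym (proj₂ (degree-bounds i₀ (from i₀) refl))
      (degree-≥′ i₀ (strictlyInverseʳ (just (spoke zero))) (cong (3 +_) (length-mates (spoke zero)))
        (neighbours-unique (spoke zero)) (spoke-neighbours zero))
    where
    i₀ : Fin (suc (m ^ d * d))
    i₀ = to (just (spoke zero))

-- The infinite family

hub-family : ∀ e N → Σ ℕ λ n → N ≤ n × Σ (SimpleGraph n) λ G →
  Ordered (3 + e) G × HasMinDegree G (2 + e) × HasMaxDegree G (5 + e)
hub-family e N = suc (m ^ (3 + e) * (3 + e)) , large , hubGraph , hubGraph-ordered , hubGraph-min , hubGraph-max
  where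
  T m : ℕ
  -- This is the room required by `d + 1` terminals, where `d = 3 + e`.
  T = (4 + e) * (3 + e) + (4 + e) * 3
  -- `suc` and the four copies of `T` give `4T < m`; the summand `N` makes the graph have at least
  -- `N` vertices.
  m = suc (T + T + (T + T) + N)
  wide : T + T + (T + T) < m
  wide = s≤s (m≤m+n _ N)
  T≤m : T ≤ m
  T≤m = ≤-trans (m≤m+n T T) (≤-trans (m≤m+n (T + T) (T + T)) (<⇒≤ wide))
  spokes : 2 + e ≤ m
  spokes = ≤-trans (≤-trans (n≤1+n (2 + e)) (≤-trans (m≤m+n (3 + e) _) (m≤m+n ((4 + e) * (3 + e)) _))) T≤m
  open HubDegrees e T m wide ≤-refl spokes
  large : N ≤ suc (m ^ (3 + e) * (3 + e))
  large = begin
    N                            ≤⟨ m≤n+m N (T + T + (T + T)) ⟩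
    T + T + (T + T) + N          ≤⟨ n≤1+n _ ⟩
    m                            ≤⟨ m≤m*n m (m ^ (2 + e)) ⟩
    m ^ (3 + e)                  ≤⟨ m≤m*n (m ^ (3 + e)) (3 + e) ⟩
    m ^ (3 + e) * (3 + e)        ≤⟨ n≤1+n _ ⟩
    suc (m ^ (3 + e) * (3 + e))  ∎
    where
    open ≤-Reasoning
    instance
      _ = m^n≢0 m (2 + e)

-- Infinitude is expressed by a graph of order at least `N` for every `N`.
theorem4p4 : (k : ℕ) → 2 ≤ k → (N : ℕ) →
    Σ ℕ λ n → N ≤ n × Σ (SimpleGraph n) λ G →
    Ordered (2 * k) G × HasMinDegree G (2 * k ∸ 1) × HasMaxDegree G (2 * k + 2)
-- Writing `2 * k` as `3 + e` turns the two degrees into `2 + e` and `5 + e`, free of truncated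
-- subtraction.
theorem4p4 k 2≤k N = subst P (proj₂ 2k≡3+e) (subst (λ b → Q (3 + e) (2 + e) b) (+-comm 2 (3 + e)) (hub-family e N))
  where
  Q : ℕ → ℕ → ℕ → Set
  Q r a b = Σ ℕ λ n → N ≤ n × Σ (SimpleGraph n) λ G → Ordered r G × HasMinDegree G a × HasMaxDegree G b
  P : ℕ → Set
  P r = Q r (r ∸ 1) (r + 2)
  2k≡3+e : ∃ λ e → 3 + e ≡ 2 * k
  2k≡3+e = m≤n⇒∃[o]m+o≡n (≤-trans (n≤1+n 3) (*-monoʳ-≤ 2 2≤k))
  e : ℕ
  e = proj₁ 2k≡3+e
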